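{- The problem Pseudosplit Completion (given a graph $G$ on $n$ vertices and a non-negative integer $k$, decide whether at most $k$ edges can be added to $G$ so that the resulting graph is pseudosplit) is solvable in time $2^{\mathcal{O}(\sqrt{k}\log k)} n^{\mathcal{O}(1)}$.
   Context: All graphs are finite, simple and undirected. $2K_2$ is the disjoint union of two edges and $C_4$ is the cycle on four vertices. A graph is pseudosplit if it contains neither $2K_2$ nor $C_4$ as an induced subgraph. Adding edges means passing from $G=(V,E)$ to a supergraph $(V,E\cup S)$ on the same vertex set, with $|S|\le k$. -}

module Defs where

open import Data.Bool using (Bool; true; false; _∧_; _∨_; if_then_else_)
open import Data.Bool.ListAction using (any)
open import Data.Bool.Properties using () renaming (_≟_ to _≟ᵇ_)
open import Data.Fin using (Fin; toℕ)
open import Data.Fin.Properties using (all?)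
open import Data.List using (List; []; _∷_; allFin; cartesianProduct; filterᵇ; length; replicate)
open import Data.Nat using (ℕ; zero; suc; _+_; _*_; _≤_; _≤ᵇ_; _<ᵇ_; _≡ᵇ_)
open import Data.Product using (∃-syntax; _×_; _,_)
open import Data.Vec using (Vec; []; _∷_; lookup)
import Data.List as List
open import Function.Definitions using (Injective)
open import Relation.Binary.PropositionalEquality using (_≡_; refl; cong₂)
open import Relation.Nullary using (¬_; Reflects)
open import Relation.Nullary.Decidable using (from-yes)

record Graph (n : ℕ) : Set where
  field
    adj    : Fin n → Fin n → Bool
    sym    : ∀ i j → adj i j ≡ adj j i
    irrefl : ∀ i → adj i i ≡ false

open Graph public

edges : ∀ {n} → Graph n → List (Fin n × Fin n)
edges {n} G =
  filterᵇ (λ (i , j) → (toℕ i <ᵇ toℕ j) ∧ adj G i j)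
          (cartesianProduct (allFin n) (allFin n))

∣E∣ : ∀ {n} → Graph n → ℕ
∣E∣ G = length (edges G)

-- (V , E) ∪ᴳ (V , S) = (V , E ∪ S).
_∪ᴳ_ : ∀ {n} → Graph n → Graph n → Graph n
(G ∪ᴳ H) .adj i j    = adj G i j ∨ adj H i j
(G ∪ᴳ H) .sym i j    = cong₂ _∨_ (sym G i j) (sym H i j)
(G ∪ᴳ H) .irrefl i   = cong₂ _∨_ (irrefl G i) (irrefl H i)

_isInducedSubgraphOf_ : ∀ {m n} → Graph m → Graph n → Set
_isInducedSubgraphOf_ {m} {n} H G =
  ∃[ φ ] Injective {A = Fin m} {B = Fin n} _≡_ _≡_ φ
       × (∀ i j → adj G (φ i) (φ j) ≡ adj H i j)

joins : List (ℕ × ℕ) → ∀ {n} → Fin n → Fin n → Bool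
joins es i j =
  any (λ (a , b) → ((toℕ i ≡ᵇ a) ∧ (toℕ j ≡ᵇ b)) ∨ ((toℕ i ≡ᵇ b) ∧ (toℕ j ≡ᵇ a))) es

2K₂ : Graph 4
2K₂ .adj    = joins ((0 , 1) ∷ (2 , 3) ∷ [])
2K₂ .sym    = from-yes (all? λ i → all? λ j → adj 2K₂ i j ≟ᵇ adj 2K₂ j i)
2K₂ .irrefl = from-yes (all? λ i → adj 2K₂ i i ≟ᵇ false)

C₄ : Graph 4
C₄ .adj    = joins ((0 , 1) ∷ (1 , 2) ∷ (2 , 3) ∷ (3 , 0) ∷ [])
C₄ .sym    = from-yes (all? λ i → all? λ j → adj C₄ i j ≟ᵇ adj C₄ j i)
C₄ .irrefl = from-yes (all? λ i → adj C₄ i i ≟ᵇ false)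

Pseudosplit : ∀ {n} → Graph n → Set
Pseudosplit G = ¬ (2K₂ isInducedSubgraphOf G) × ¬ (C₄ isInducedSubgraphOf G)

-- The set S of added edges is itself presented as a graph on the vertices of G.
PseudosplitCompletion : ∀ {n} → Graph n → ℕ → Set
PseudosplitCompletion {n} G k =
  ∃[ S ] ∣E∣ {n} S ≤ k × Pseudosplit (G ∪ᴳ S)

-- A first-order, call-by-value functional language over binary trees
-- ("pure LISP"), in which every evaluation step costs one unit of time.
-- With trees represented by pointers, each step takes constant time on a
-- pointer machine or RAM (the constant depends on the program only), and
-- conversely the language simulates Turing machines with polynomial
-- overhead.  It is therefore polynomially equivalent to the usual models,
-- and the bound 2^{O(√k log k)} n^{O(1)} is invariant under polynomial
-- changes of the running time.

infixr 5 _∙_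

data Tree : Set where
  nil : Tree
  _∙_ : Tree → Tree → Tree

-- Expressions with v variables (de Bruijn indices) that may call m
-- functions of the given arities.
data Exp {m : ℕ} (arity : Fin m → ℕ) (v : ℕ) : Set where
  var   : Fin v → Exp arity v
  nilᵉ  : Exp arity v
  _∙ᵉ_  : Exp arity v → Exp arity v → Exp arity v
  -- caseᵉ e a b: if e is nil then a; if e is x ∙ y then b, where
  -- variable 0 is x and variable 1 is y.
  caseᵉ : Exp arity v → Exp arity v → Exp arity (suc (suc v)) → Exp arity v
  letᵉ  : Exp arity v → Exp arity (suc v) → Exp arity v
  call  : (f : Fin m) → Vec (Exp arity v) (arity f) → Exp arity v

-- The functions may be mutually recursive; variable 0 of main is the input.
record Program : Set where
  field
    {numFuns} : ℕ
    arity     : Fin numFuns → ℕ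
    body      : ∀ f → Exp arity (arity f)
    main      : Exp arity 1

module Semantics (P : Program) where
  open Program P

  infix 4 _⊢_⇓_#_ _⊢_⇓*_#_

  -- ρ ⊢ e ⇓ x # t: in environment ρ, e evaluates to x in time t.
  mutual
    data _⊢_⇓_#_ {v} (ρ : Vec Tree v) : Exp arity v → Tree → ℕ → Set where
      ⇓var : ∀ {i} → ρ ⊢ var i ⇓ lookup ρ i # 1
      ⇓nil : ρ ⊢ nilᵉ ⇓ nil # 1
      ⇓∙   : ∀ {a b x y s t} →
             ρ ⊢ a ⇓ x # s → ρ ⊢ b ⇓ y # t →
             ρ ⊢ a ∙ᵉ b ⇓ x ∙ y # suc (s + t)
      ⇓case-nil : ∀ {e a b z s t} →
             ρ ⊢ e ⇓ nil # s → ρ ⊢ a ⇓ z # t →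
             ρ ⊢ caseᵉ e a b ⇓ z # suc (s + t)
      ⇓case-∙ : ∀ {e a b x y z s t} →
             ρ ⊢ e ⇓ x ∙ y # s → x ∷ y ∷ ρ ⊢ b ⇓ z # t →
             ρ ⊢ caseᵉ e a b ⇓ z # suc (s + t)
      ⇓let : ∀ {a b x z s t} →
             ρ ⊢ a ⇓ x # s → x ∷ ρ ⊢ b ⇓ z # t →
             ρ ⊢ letᵉ a b ⇓ z # suc (s + t)
      ⇓call : ∀ {f es xs z s t} →
             ρ ⊢ es ⇓* xs # s → xs ⊢ body f ⇓ z # t →
             ρ ⊢ call f es ⇓ z # suc (s + t)

    data _⊢_⇓*_#_ {v} (ρ : Vec Tree v) :
         ∀ {l} → Vec (Exp arity v) l → Vec Tree l → ℕ → Set where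
      ⇓[] : ρ ⊢ [] ⇓* [] # 0
      ⇓∷  : ∀ {l e x s t} {es : Vec (Exp arity v) l} {xs} →
            ρ ⊢ e ⇓ x # s → ρ ⊢ es ⇓* xs # t →
            ρ ⊢ e ∷ es ⇓* x ∷ xs # (s + t)

  mutual
    ⇓-deterministic : ∀ {v} {ρ : Vec Tree v} {e x y s t} →
      ρ ⊢ e ⇓ x # s → ρ ⊢ e ⇓ y # t → (x , s) ≡ (y , t)
    ⇓-deterministic ⇓var ⇓var = refl
    ⇓-deterministic ⇓nil ⇓nil = refl
    ⇓-deterministic (⇓∙ p q) (⇓∙ p′ q′)
      with refl ← ⇓-deterministic p p′ | refl ← ⇓-deterministic q q′ = refl
    ⇓-deterministic (⇓case-nil p q) (⇓case-nil p′ q′)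
      with refl ← ⇓-deterministic p p′ | refl ← ⇓-deterministic q q′ = refl
    ⇓-deterministic (⇓case-nil p _) (⇓case-∙ p′ _) with () ← ⇓-deterministic p p′
    ⇓-deterministic (⇓case-∙ p _) (⇓case-nil p′ _) with () ← ⇓-deterministic p p′
    ⇓-deterministic (⇓case-∙ p q) (⇓case-∙ p′ q′)
      with refl ← ⇓-deterministic p p′
      with refl ← ⇓-deterministic q q′ = refl
    ⇓-deterministic (⇓let p q) (⇓let p′ q′)
      with refl ← ⇓-deterministic p p′
      with refl ← ⇓-deterministic q q′ = refl
    ⇓-deterministic (⇓call p q) (⇓call p′ q′)
      with refl ← ⇓*-deterministic p p′
      with refl ← ⇓-deterministic q q′ = refl

    ⇓*-deterministic : ∀ {v} {ρ : Vec Tree v} {l} {es : Vec (Exp arity v) l} {xs ys s t} →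
      ρ ⊢ es ⇓* xs # s → ρ ⊢ es ⇓* ys # t → (xs , s) ≡ (ys , t)
    ⇓*-deterministic ⇓[] ⇓[] = refl
    ⇓*-deterministic (⇓∷ p q) (⇓∷ p′ q′)
      with refl ← ⇓-deterministic p p′ | refl ← ⇓*-deterministic q q′ = refl

encodeBool : Bool → Tree
encodeBool false = nil
encodeBool true  = nil ∙ nil

encodeList : List Tree → Tree
encodeList []       = nil
encodeList (x ∷ xs) = x ∙ encodeList xs

-- Unary.  Whether k is given in unary or in binary is immaterial here:
-- converting costs k^{O(1)} ≤ 2^{O(√k log k)} time.
encodeℕ : ℕ → Tree
encodeℕ k = encodeList (replicate k nil)

-- The adjacency matrix, as the list of its rows.
encodeGraph : ∀ {n} → Graph n → Tree
encodeGraph {n} G =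
  encodeList (List.tabulate {n = n} λ i →
    encodeList (List.tabulate {n = n} λ j → encodeBool (adj G i j)))

-- On the given input, P halts within the given time and correctly answers
-- whether A holds.
_on_Decides_Within_ : Program → Tree → Set → ℕ → Set
P on input Decides A Within bound =
  ∃[ b ] ∃[ t ] (input ∷ [] ⊢ Program.main P ⇓ encodeBool b # t)
              × Reflects A b
              × t ≤ bound
  where open Semantics P

infix 4 _∈O_

_∈O_ : (ℕ → ℕ) → (ℕ → ℕ) → Set
f ∈O g = ∃[ C ] ∃[ k₀ ] (∀ k → k₀ ≤ k → f k ≤ C * g k)

⌊√_⌋ : ℕ → ℕ
⌊√ zero ⌋  = 0
⌊√ suc k ⌋ = next ⌊√ k ⌋
  where
  next : ℕ → ℕ
  next s = if suc s * suc s ≤ᵇ suc k then suc s else s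

{-# OPTIONS --safe #-}
module Submission where

-- A pseudosplit graph is either a split graph, or has an induced 5-cycle X all
-- of whose other vertices are complete to X and form a clique, or anticomplete
-- to X and form an independent set.  After guessing X (n⁵ ways), one looks for
-- an independent set I, disjoint from and anticomplete to X, such that at most
-- k + 5 pairs of V ∖ I are non-adjacent, where 5 accounts for the chords of X.
--
-- This is solved by iterative compression.  Given such a partition (C , I) and
-- a new vertex v, let I′ be the independent side of any solution and A = I′ ∖ I.
-- Moving the vertices of I without neighbours in A to the independent side only
-- shrinks the clique side, so I′ may be taken to be A together with these, and
-- is determined by A.  Since C has at most s² missing pairs, where s = O(√k), it
-- has at most 2ˢ (1 + n 2ˢ) independent subsets A, and all of them can be tried.

open import Data.Bool using (Bool; true; false; not; _∧_; _∨_; _xor_; if_then_else_; T?)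
open import Data.Bool.ListAction using (any)
open import Data.Bool.Properties using (T-≡; ¬-not; not-¬; ∨-zeroʳ; ∨-identityʳ) renaming (_≟_ to _≟ᵇ_)
open import Data.Empty using (⊥; ⊥-elim)
open import Data.Fin using (Fin; zero; suc; toℕ; _↑ʳ_)
open import Data.Fin.Patterns
import Data.Fin.Properties as Fin
open import Data.List using (List; []; _∷_; _++_; length; map; filterᵇ; drop; replicate; tabulate; allFin; cartesianProduct)
import Data.List as List
open import Data.List.Membership.Propositional using (_∈_; find; lose)
open import Data.List.Membership.Propositional.Properties
  using (∈-++⁻; ∈-++⁺ˡ; ∈-++⁺ʳ; ∈-lookup; ∈-map⁺; ∈-map⁻; ∈-filter⁺; ∈-filter⁻; ∈-∃++; ∈-cartesianProduct⁺;
         ∈-allFin; ∈-tabulate⁺; ∈-tabulate⁻)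
open import Data.List.Properties using (length-++; length-map; length-replicate; length-tabulate; map-tabulate; filter-++)
open import Data.List.Relation.Binary.Sublist.Propositional using ([]; _∷_; _∷ʳ_) renaming (_⊆_ to _⊑_; ⊆-refl to ⊑-refl)
open import Data.List.Relation.Binary.Sublist.Propositional.Properties using (filter-⊆; length-mono-≤)
open import Data.List.Relation.Binary.Subset.Propositional using (_⊆_)
open import Data.List.Relation.Unary.All using ([]; _∷_)
import Data.List.Relation.Unary.All as All
open import Data.List.Relation.Unary.AllPairs using (AllPairs; []; _∷_; allPairs?)
import Data.List.Relation.Unary.AllPairs as AllPairs
import Data.List.Relation.Unary.AllPairs.Properties as AllPairs
open import Data.List.Relation.Unary.Any using (here; there; index; any?)
import Data.List.Relation.Unary.Any as Any
open import Data.List.Relation.Unary.Any.Properties using (lookup-index)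
open import Data.List.Relation.Unary.Unique.Propositional using (Unique)
import Data.List.Relation.Unary.Unique.Propositional.Properties as Unique
open import Data.Maybe using (Maybe; just; nothing; is-just)
open import Data.Nat using (ℕ; zero; suc; _+_; _*_; _^_; _∸_; _≤_; _<_; _≤ᵇ_; _<ᵇ_; _≤?_; z≤n; s≤s; NonZero; >-nonZero)
open import Data.Nat.Logarithm using (⌊log₂_⌋; ⌊log₂⌋-mono-≤)
open import Data.Nat.Properties
open import Data.Nat.Tactic.RingSolver using (solve-∀)
open import Data.Product using (_×_; _,_; ∃-syntax; proj₁; proj₂)
open import Data.Product.Properties using (≡-dec)
open import Data.Sum using (_⊎_; inj₁; inj₂)
open import Data.Vec using (Vec; []; _∷_)
import Data.Vec as Vec
import Data.Vec.Properties as Vec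
open import Function using (_∘_; Equivalence)
open import Relation.Binary.PropositionalEquality
  using (_≡_; _≢_; refl; sym; trans; cong; cong₂; subst; ≢-sym; module ≡-Reasoning)
open import Relation.Nullary using (¬_; Dec; yes; no; does; Reflects; ofʸ; ofⁿ)
open import Relation.Nullary.Decidable using (from-yes; dec-true; dec-false; _×-dec_; _→-dec_; _⊎-dec_; ¬?)
open import Relation.Unary using (Decidable)
open import Defs hiding (sym)

-- Time is measured in the given language, so the algorithm occurs twice: as Agda functions, about
-- which correctness is proved, and as a `Term`, which is shown to compute them. Terms can recurse
-- only by folding over lists. Once every folded list has length at most `Q`, the time is at most
-- `Q` to a power read off the syntax, so the timing reduces to bounding list lengths. Lists of
-- vertices and unary numbers are short for trivial reasons; the lists of candidate sets `A` are the
-- exception, and counting independent sets in a nearly complete graph bounds them. A value `Q` =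
-- 2^O(√k) (1 + n) suffices.
--
-- The guessed pentagon need not be present in `G`: its corners must be distinct and its chords
-- absent, while missing cycle edges are paid for like any other missing pair of the clique side.
-- The chords lie on that side as well but must stay missing, which is why the budget rises by
-- exactly 5.
--
-- That one of the two structures always exists is proved by inserting vertices one at a time; that
-- either structure implies pseudosplit is a finite check over seven labels.

-- The source language and its compilation

-- In foldᵗ e N C the branch C sees the value on the tail, the head, the tail
-- and the whole list as variables 0 to 3; in N, variable 0 is the empty list.
data Term (v : ℕ) : Set where
  var   : Fin v → Term v
  nilᵗ  : Term v
  _∙ᵗ_  : Term v → Term v → Term v
  caseᵗ : Term v → Term v → Term (2 + v) → Term v
  callᵗ : ∀ {l} → Term l → Vec (Term v) l → Term v
  foldᵗ : Term v → Term (1 + v) → Term (4 + v) → Term v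

infixr 5 _∙ᵗ_

data Fun : Set where
  fn   : ∀ {l} → Term l → Fun
  loop : ∀ {v} → Term (1 + v) → Term (4 + v) → Fun

arityOf : Fun → ℕ
arityOf (fn {l} _)     = l
arityOf (loop {v} _ _) = suc v

mutual
  funs : ∀ {v} → Term v → List Fun
  funs (var _)       = []
  funs nilᵗ          = []
  funs (a ∙ᵗ b)      = funs a ++ funs b
  funs (caseᵗ e a b) = funs e ++ funs a ++ funs b
  funs (callᵗ t es)  = fn t ∷ funs t ++ funs* es
  funs (foldᵗ e a b) = loop a b ∷ funs e ++ funs a ++ funs b

  funs* : ∀ {v l} → Vec (Term v) l → List Fun
  funs* []       = []
  funs* (e ∷ es) = funs e ++ funs* es

bodies : Fun → List Fun
bodies (fn t)     = funs t
bodies (loop a b) = funs a ++ funs b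

private
  module _ {xs ys zs : List Fun} where
    ∪-⊆ : ∀ {x} → (x ∈ xs → bodies x ⊆ zs) → (x ∈ ys → bodies x ⊆ zs) → x ∈ xs ++ ys → bodies x ⊆ zs
    ∪-⊆ f g p with ∈-++⁻ xs p
    ... | inj₁ q = f q
    ... | inj₂ q = g q

  inl : ∀ {xs ys : List Fun} → xs ⊆ xs ++ ys
  inl = ∈-++⁺ˡ

  inr : ∀ (xs : List Fun) {ys} → ys ⊆ xs ++ ys
  inr xs = ∈-++⁺ʳ xs

mutual
  -- The function table of a compiled program is `funs` of its main term. Closure under `bodies`
  -- lets every table entry resolve the calls in its own body within that same table.
  funs-closed : ∀ {v} (e : Term v) {x} → x ∈ funs e → bodies x ⊆ funs e
  funs-closed (a ∙ᵗ b) =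
    ∪-⊆ (λ p → inl ∘ funs-closed a p) (λ p → inr (funs a) ∘ funs-closed b p)
  funs-closed (caseᵗ e a b) =
    ∪-⊆ (λ p → inl ∘ funs-closed e p)
      (∪-⊆ (λ p → inr (funs e) ∘ inl ∘ funs-closed a p)
           (λ p → inr (funs e) ∘ inr (funs a) ∘ funs-closed b p))
  funs-closed (callᵗ t es) (here refl) = there ∘ inl
  funs-closed (callᵗ t es) (there q) =
    ∪-⊆ (λ p → there ∘ inl ∘ funs-closed t p) (λ p → there ∘ inr (funs t) ∘ funs*-closed es p) q
  funs-closed (foldᵗ e a b) (here refl) = there ∘ inr (funs e)
  funs-closed (foldᵗ e a b) (there q) =
    ∪-⊆ (λ p → there ∘ inl ∘ funs-closed e p)
      (∪-⊆ (λ p → there ∘ inr (funs e) ∘ inl ∘ funs-closed a p)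
           (λ p → there ∘ inr (funs e) ∘ inr (funs a) ∘ funs-closed b p)) q

  funs*-closed : ∀ {v l} (es : Vec (Term v) l) {x} → x ∈ funs* es → bodies x ⊆ funs* es
  funs*-closed (e ∷ es) =
    ∪-⊆ (λ p → inl ∘ funs-closed e p) (λ p → inr (funs e) ∘ funs*-closed es p)

module Compiler (fs : List Fun) where

  ar : Fin (length fs) → ℕ
  ar i = arityOf (List.lookup fs i)

  -- The arity stored in the table agrees with `arityOf x` only up to a proof, hence the transport.
  -- Index and proof are kept general so that `invokeAt-⇓` can match the proof with `refl`.
  invokeAt : ∀ {v x} i → x ≡ List.lookup fs i → Vec (Exp ar v) (arityOf x) → Exp ar v
  invokeAt i eq es = call i (subst (λ y → Vec (Exp ar _) (arityOf y)) eq es)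

  invoke : ∀ {v x} → x ∈ fs → Vec (Exp ar v) (arityOf x) → Exp ar v
  invoke x∈fs = invokeAt (index x∈fs) (lookup-index x∈fs)

  vars : ∀ {w} v → (Fin v → Fin w) → Vec (Exp ar w) v
  vars v g = Vec.tabulate (var ∘ g)

  mutual
    compile : ∀ {v} (e : Term v) → funs e ⊆ fs → Exp ar v
    compile (var i)       s = var i
    compile nilᵗ          s = nilᵉ
    compile (a ∙ᵗ b)      s = compile a (s ∘ inl) ∙ᵉ compile b (s ∘ inr (funs a))
    compile (caseᵗ e a b) s =
      caseᵉ (compile e (s ∘ inl)) (compile a (s ∘ inr (funs e) ∘ inl))
            (compile b (s ∘ inr (funs e) ∘ inr (funs a)))
    compile (callᵗ t es)  s =
      invoke (s (here refl)) (compile* es (s ∘ there ∘ inr (funs t)))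
    compile {v} (foldᵗ e a b) s =
      invoke (s (here refl)) (compile e (s ∘ there ∘ inl) ∷ vars v (λ i → i))

    compile* : ∀ {v l} (es : Vec (Term v) l) → funs* es ⊆ fs → Vec (Exp ar v) l
    compile* []       s = []
    compile* (e ∷ es) s = compile e (s ∘ inl) ∷ compile* es (s ∘ inr (funs e))

  compileFun : (x : Fun) → x ∈ fs → bodies x ⊆ fs → Exp ar (arityOf x)
  compileFun (fn t)         x∈fs s = compile t s
  compileFun (loop {v} a b) x∈fs s =
    caseᵉ (var zero) (compile a (s ∘ inl))
      -- In this branch the environment is head, tail, whole list, then the outer variables, which
      -- `3 ↑ʳ_` passes on unchanged. The `let` puts the recursive value in front, giving the
      -- four-variable layout that `b` expects.
      (letᵉ (invoke x∈fs (var (suc zero) ∷ vars v (3 ↑ʳ_))) (compile b (s ∘ inr (funs a))))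

  bodyAt : (∀ {x} → x ∈ fs → bodies x ⊆ fs) → ∀ i → Exp ar (ar i)
  bodyAt closed i = compileFun (List.lookup fs i) (∈-lookup i) (closed (∈-lookup i))

compileProgram : Term 1 → Program
compileProgram e = record
  { arity = ar ; body = bodyAt (funs-closed e) ; main = compile e (λ p → p) }
  where open Compiler (funs e)

-- Running time of compiled terms

spine : Tree → ℕ
spine nil      = 0
spine (_ ∙ xs) = suc (spine xs)

mutual
  -- The exponent of `Q` in the time bound. Degrees are added, so Q^a and Q^b are both at most
  -- Q^(a+b), and each node has a factor `Q` to spare for the sum of its parts. A fold also pays for
  -- its iterations and for passing on `v` variables in each, which v ≤ Q^v absorbs.
  deg : ∀ {v} → Term v → ℕ
  deg (var _)       = 0
  deg nilᵗ          = 0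
  deg (a ∙ᵗ b)      = suc (deg a + deg b)
  deg (caseᵗ e a b) = suc (deg e + (deg a + deg b))
  deg (callᵗ t es)  = suc (deg* es + deg t)
  deg {v} (foldᵗ e a b) = 3 + (deg e + (v + (deg a + deg b)))

  deg* : ∀ {v l} → Vec (Term v) l → ℕ
  deg* []       = 0
  deg* (e ∷ es) = suc (deg e + deg* es)

module Run (Q : ℕ) where

  infix 4 _⊨_⇒_ _⊨*_⇒_

  -- ρ ⊨ e ⇒ x: in environment ρ, e evaluates to x and all lists that are
  -- folded over have length at most Q.
  mutual
    data _⊨_⇒_ {v} (ρ : Vec Tree v) : Term v → Tree → Set where
      ⇒var : ∀ {i} → ρ ⊨ var i ⇒ Vec.lookup ρ i
      ⇒nil : ρ ⊨ nilᵗ ⇒ nil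
      ⇒∙   : ∀ {a b x y} → ρ ⊨ a ⇒ x → ρ ⊨ b ⇒ y → ρ ⊨ a ∙ᵗ b ⇒ x ∙ y
      ⇒case-nil : ∀ {e a b z} → ρ ⊨ e ⇒ nil → ρ ⊨ a ⇒ z → ρ ⊨ caseᵗ e a b ⇒ z
      ⇒case-∙ : ∀ {e a b x y z} → ρ ⊨ e ⇒ x ∙ y → x ∷ y ∷ ρ ⊨ b ⇒ z → ρ ⊨ caseᵗ e a b ⇒ z
      ⇒call : ∀ {l} {t : Term l} {es xs z} → ρ ⊨* es ⇒ xs → xs ⊨ t ⇒ z → ρ ⊨ callᵗ t es ⇒ z
      ⇒fold : ∀ {e a b xs z} → ρ ⊨ e ⇒ xs → spine xs ≤ Q → Loop ρ a b xs z → ρ ⊨ foldᵗ e a b ⇒ z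

    data _⊨*_⇒_ {v} (ρ : Vec Tree v) : ∀ {l} → Vec (Term v) l → Vec Tree l → Set where
      []  : ρ ⊨* [] ⇒ []
      _∷_ : ∀ {l e x} {es : Vec (Term v) l} {xs} → ρ ⊨ e ⇒ x → ρ ⊨* es ⇒ xs → ρ ⊨* e ∷ es ⇒ x ∷ xs

    data Loop {v} (ρ : Vec Tree v) (a : Term (1 + v)) (b : Term (4 + v)) : Tree → Tree → Set where
      loop-nil : ∀ {z} → nil ∷ ρ ⊨ a ⇒ z → Loop ρ a b nil z
      loop-∙   : ∀ {x xs y z} → Loop ρ a b xs y →
                 y ∷ x ∷ xs ∷ (x ∙ xs) ∷ ρ ⊨ b ⇒ z → Loop ρ a b (x ∙ xs) z

  module _ (16≤Q : 16 ≤ Q) where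

    private
      instance
        Q≢0 : NonZero Q
        Q≢0 = >-nonZero (≤-trans (s≤s z≤n) 16≤Q)

      Q^ : ∀ {a b} → a ≤ b → Q ^ a ≤ Q ^ b
      Q^ = ^-monoʳ-≤ Q

      1≤Q^ : ∀ a → 1 ≤ Q ^ a
      1≤Q^ a = Q^ {0} {a} z≤n

      v≤Q^v : ∀ v → v ≤ Q ^ v
      v≤Q^v zero    = z≤n
      v≤Q^v (suc v) = begin
        suc v         ≤⟨ +-mono-≤ (1≤Q^ v) (v≤Q^v v) ⟩
        Q ^ v + Q ^ v ≡⟨ cong (Q ^ v +_) (sym (+-identityʳ (Q ^ v))) ⟩
        2 * Q ^ v     ≤⟨ *-monoˡ-≤ (Q ^ v) (≤-trans (s≤s (s≤s z≤n)) 16≤Q) ⟩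
        Q * Q ^ v     ∎
        where open ≤-Reasoning

      three : ∀ {c s t} d → c ≤ Q ^ d → s ≤ Q ^ d → t ≤ Q ^ d → c + (s + t) ≤ Q ^ suc d
      three {c} {s} {t} d p q r = begin
        c + (s + t)                     ≤⟨ +-mono-≤ p (+-mono-≤ q r) ⟩
        Q ^ d + (Q ^ d + Q ^ d)         ≡⟨ cong (λ z → Q ^ d + (Q ^ d + z)) (sym (+-identityʳ (Q ^ d))) ⟩
        3 * Q ^ d                       ≤⟨ *-monoˡ-≤ (Q ^ d) (≤-trans (s≤s (s≤s (s≤s z≤n))) 16≤Q) ⟩
        Q * Q ^ d                       ∎
        where open ≤-Reasoning

      sum₂ : ∀ {s t} a b → s ≤ Q ^ a → t ≤ Q ^ b → suc (s + t) ≤ Q ^ suc (a + b)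
      sum₂ a b p q = three (a + b) (1≤Q^ (a + b)) (≤-trans p (Q^ (m≤m+n a b))) (≤-trans q (Q^ (m≤n+m b a)))

      loop-sum : ∀ {r v} e d → r ≤ Q ^ e → v ≤ Q ^ d →
                 ∀ {t} → t ≤ suc Q * (5 + (v + (Q ^ d + Q ^ d))) →
                 suc ((r + v) + t) ≤ Q ^ (3 + (e + d))
      loop-sum {r} {v} e d p q {t} h = begin
        suc ((r + v) + t)
          ≤⟨ s≤s (+-mono-≤ (+-mono-≤ (≤-trans p (Q^ (m≤m+n e d))) (≤-trans q Q^d≤)) h) ⟩
        suc ((P + P) + suc Q * (5 + (v + (Q ^ d + Q ^ d))))
          ≤⟨ s≤s (+-monoʳ-≤ (P + P) (*-monoʳ-≤ (suc Q)
               (+-mono-≤ (*-monoʳ-≤ 5 1≤P) (+-mono-≤ (≤-trans q Q^d≤) (+-mono-≤ Q^d≤ Q^d≤))))) ⟩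
        suc ((P + P) + suc Q * (5 * P + (P + (P + P))))
          ≤⟨ +-monoˡ-≤ _ 1≤P ⟩
        P + ((P + P) + suc Q * (5 * P + (P + (P + P))))
          ≡⟨ expand P Q ⟩
        (11 + 8 * Q) * P
          -- Here 11 ≤ Q and 8Q ≤ 15Q; the following step turns 16 into a second factor `Q`. This
          -- sets the requirement 16 ≤ Q.
          ≤⟨ *-monoˡ-≤ P (+-mono-≤ (≤-trans (m≤m+n 11 5) 16≤Q) (*-monoˡ-≤ Q {8} {15} (m≤m+n 8 7))) ⟩
        (16 * Q) * P
          ≤⟨ *-monoˡ-≤ P (*-monoˡ-≤ Q 16≤Q) ⟩
        (Q * Q) * P
          ≡⟨ *-assoc Q Q P ⟩
        Q ^ (2 + (e + d))
          ≤⟨ Q^ (n≤1+n (2 + (e + d))) ⟩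
        Q ^ (3 + (e + d)) ∎
        where
          open ≤-Reasoning
          P = Q ^ (e + d)
          1≤P = 1≤Q^ (e + d)
          Q^d≤ : Q ^ d ≤ P
          Q^d≤ = Q^ (m≤n+m d e)
          expand : ∀ P Q → P + ((P + P) + suc Q * (5 * P + (P + (P + P)))) ≡ (11 + 8 * Q) * P
          expand = solve-∀

    module _ (e₀ : Term 1) where

      private
        fs = funs e₀
        prog = compileProgram e₀
      open Compiler fs
      open Semantics prog

      vars-⇓ : ∀ {w} {ρ : Vec Tree w} v (g : Fin v → Fin w) →
               ρ ⊢ vars v g ⇓* Vec.tabulate (Vec.lookup ρ ∘ g) # v
      vars-⇓ zero    g = ⇓[]
      vars-⇓ (suc v) g = ⇓∷ ⇓var (vars-⇓ v (g ∘ suc))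

      env-⇓ : ∀ {w v} {ρ′ : Vec Tree w} {ρ : Vec Tree v} (g : Fin v → Fin w) →
              (∀ i → Vec.lookup ρ′ (g i) ≡ Vec.lookup ρ i) → ρ′ ⊢ vars v g ⇓* ρ # v
      env-⇓ {v = v} {ρ′} {ρ} g eq = subst (λ xs → ρ′ ⊢ vars v g ⇓* xs # v)
        (trans (Vec.tabulate-cong eq) (Vec.tabulate∘lookup ρ)) (vars-⇓ v g)

      -- The table compiles the body with its own membership and closure proofs, not those of the
      -- call site, so the hypothesis on the body must hold uniformly in both.
      invokeAt-⇓ : ∀ {v x i} (eq : x ≡ List.lookup fs i) {ρ : Vec Tree v} {es xs s z B} →
        ρ ⊢ es ⇓* xs # s →
        (∀ (x∈fs : x ∈ fs) (c : bodies x ⊆ fs) → ∃[ t ] (xs ⊢ compileFun x x∈fs c ⇓ z # t) × t ≤ B) →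
        ∃[ t ] (ρ ⊢ invokeAt i eq es ⇓ z # suc (s + t)) × t ≤ B
      invokeAt-⇓ {i = i} refl p body with body (∈-lookup i) (funs-closed e₀ (∈-lookup i))
      ... | t , q , t≤B = t , ⇓call p q , t≤B

      invoke-⇓ : ∀ {v x} (x∈fs : x ∈ fs) {ρ : Vec Tree v} {es xs s z B} →
        ρ ⊢ es ⇓* xs # s →
        (∀ (x∈fs : x ∈ fs) (c : bodies x ⊆ fs) → ∃[ t ] (xs ⊢ compileFun x x∈fs c ⇓ z # t) × t ≤ B) →
        ∃[ t ] (ρ ⊢ invoke x∈fs es ⇓ z # suc (s + t)) × t ≤ B
      invoke-⇓ x∈fs = invokeAt-⇓ (lookup-index x∈fs)

      mutual
        compile-⇓ : ∀ {v} {ρ : Vec Tree v} {e x} → ρ ⊨ e ⇒ x → (s : funs e ⊆ fs) →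
                    ∃[ t ] (ρ ⊢ compile e s ⇓ x # t) × t ≤ Q ^ deg e
        compile-⇓ ⇒var s = 1 , ⇓var , ≤-refl
        compile-⇓ ⇒nil s = 1 , ⇓nil , ≤-refl
        compile-⇓ {e = a ∙ᵗ b} (⇒∙ p q) s
          with t₁ , d₁ , le₁ ← compile-⇓ p (s ∘ inl)
             | t₂ , d₂ , le₂ ← compile-⇓ q (s ∘ inr (funs a))
          = _ , ⇓∙ d₁ d₂ , sum₂ (deg a) (deg b) le₁ le₂
        compile-⇓ {e = caseᵗ e a b} (⇒case-nil p q) s
          with t₁ , d₁ , le₁ ← compile-⇓ p (s ∘ inl)
             | t₂ , d₂ , le₂ ← compile-⇓ q (s ∘ inr (funs e) ∘ inl)
          = _ , ⇓case-nil d₁ d₂ ,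
            sum₂ (deg e) (deg a + deg b) le₁ (≤-trans le₂ (Q^ (m≤m+n (deg a) (deg b))))
        compile-⇓ {e = caseᵗ e a b} (⇒case-∙ p q) s
          with t₁ , d₁ , le₁ ← compile-⇓ p (s ∘ inl)
             | t₂ , d₂ , le₂ ← compile-⇓ q (s ∘ inr (funs e) ∘ inr (funs a))
          = _ , ⇓case-∙ d₁ d₂ ,
            sum₂ (deg e) (deg a + deg b) le₁ (≤-trans le₂ (Q^ (m≤n+m (deg b) (deg a))))
        compile-⇓ {e = callᵗ t es} (⇒call p q) s
          with t₁ , d₁ , le₁ ← compile*-⇓ p (s ∘ there ∘ inr (funs t))
          with t₂ , d₂ , le₂ ← invoke-⇓ (s (here refl)) d₁ (λ _ c → compile-⇓ q c)
          = _ , d₂ , sum₂ (deg* es) (deg t) le₁ le₂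
        compile-⇓ {v} {ρ} {e = foldᵗ e a b} (⇒fold p len q) s
          with t₁ , d₁ , le₁ ← compile-⇓ p (s ∘ there ∘ inl)
          with t₂ , d₂ , le₂ ← invoke-⇓ (s (here refl)) (⇓∷ d₁ (env-⇓ (λ i → i) (λ _ → refl)))
                                 (λ x∈fs c → loop-⇓ q x∈fs c)
          = _ , d₂ ,
            loop-sum (deg e) m le₁ (≤-trans (v≤Q^v v) (Q^ (m≤m+n v _)))
              (≤-trans le₂ (*-mono-≤ (s≤s len)
                (+-monoʳ-≤ 5 (+-monoʳ-≤ v (+-mono-≤
                  (Q^ (≤-trans (m≤m+n (deg a) (deg b)) (m≤n+m _ v)))
                  (Q^ (≤-trans (m≤n+m (deg b) (deg a)) (m≤n+m _ v))))))))
          where m = v + (deg a + deg b)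

        compile*-⇓ : ∀ {v l} {ρ : Vec Tree v} {es : Vec (Term v) l} {xs} → ρ ⊨* es ⇒ xs →
                     (s : funs* es ⊆ fs) → ∃[ t ] (ρ ⊢ compile* es s ⇓* xs # t) × t ≤ Q ^ deg* es
        compile*-⇓ [] s = 0 , ⇓[] , z≤n
        compile*-⇓ {es = e ∷ es} (p ∷ ps) s
          with t₁ , d₁ , le₁ ← compile-⇓ p (s ∘ inl)
             | t₂ , d₂ , le₂ ← compile*-⇓ ps (s ∘ inr (funs e))
          = _ , ⇓∷ d₁ d₂ , ≤-trans (n≤1+n _) (sum₂ (deg e) (deg* es) le₁ le₂)

        loop-⇓ : ∀ {v} {ρ : Vec Tree v} {a b xs z} → Loop ρ a b xs z →
                 (x∈fs : loop a b ∈ fs) (c : funs a ++ funs b ⊆ fs) →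
                 ∃[ t ] (xs ∷ ρ ⊢ compileFun (loop a b) x∈fs c ⇓ z # t) ×
                        t ≤ suc (spine xs) * (5 + (v + (Q ^ deg a + Q ^ deg b)))
        loop-⇓ {v} {a = a} {b} (loop-nil p) x∈fs c
          with t , d , le ← compile-⇓ p (c ∘ inl)
          = _ , ⇓case-nil ⇓var d , (begin
              2 + t                                 ≤⟨ +-mono-≤ (m≤m+n 2 3) le ⟩
              5 + Q ^ deg a                         ≤⟨ +-monoʳ-≤ 5 (≤-trans (m≤m+n (Q ^ deg a) (Q ^ deg b)) (m≤n+m _ v)) ⟩
              5 + (v + (Q ^ deg a + Q ^ deg b))     ≡⟨ sym (+-identityʳ _) ⟩
              5 + (v + (Q ^ deg a + Q ^ deg b)) + 0 ∎)
          where open ≤-Reasoning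
        loop-⇓ {v} {a = a} {b} (loop-∙ {xs = xs} p q) x∈fs c
          with t₁ , d₁ , le₁ ← invoke-⇓ x∈fs (⇓∷ ⇓var (env-⇓ (3 ↑ʳ_) (λ _ → refl))) (λ x∈fs c → loop-⇓ p x∈fs c)
             | t₂ , d₂ , le₂ ← compile-⇓ q (c ∘ inr (funs a))
          = _ , ⇓case-∙ ⇓var (⇓let d₁ d₂) , (begin
              -- The five units are the `case`, its scrutinee, the `let`, the call and the variable
              -- holding the tail; the copied environment takes `v` more.
              suc (1 + suc (suc (suc v + t₁) + t₂)) ≡⟨ arrange v t₁ t₂ ⟩
              5 + (v + t₂) + t₁                     ≤⟨ +-mono-≤ (+-monoʳ-≤ 5 (+-monoʳ-≤ v (≤-trans le₂ (m≤n+m _ (Q ^ deg a))))) le₁ ⟩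
              suc (suc (spine xs)) * (5 + (v + (Q ^ deg a + Q ^ deg b))) ∎)
          where
            open ≤-Reasoning
            arrange : ∀ v t₁ t₂ → suc (1 + suc (suc (suc v + t₁) + t₂)) ≡ 5 + (v + t₂) + t₁
            arrange = solve-∀

      compileProgram-⇓ : ∀ {x y} → x ∷ [] ⊨ e₀ ⇒ y →
        ∃[ t ] (x ∷ [] ⊢ Program.main prog ⇓ y # t) × t ≤ Q ^ deg e₀
      compileProgram-⇓ p = compile-⇓ p (λ q → q)

-- The algorithm

module _ {A : Set} {p : A → Bool} where

  any⁺ : ∀ {x xs} → x ∈ xs → p x ≡ true → any p xs ≡ true
  any⁺ {xs = y ∷ xs} (here refl) px rewrite px = refl
  any⁺ {xs = y ∷ xs} (there x∈) px with p y
  ... | true  = refl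
  ... | false = any⁺ x∈ px

  any⁻ : ∀ xs → any p xs ≡ true → ∃[ x ] x ∈ xs × p x ≡ true
  any⁻ (y ∷ xs) h with p y in eq
  ... | true  = y , here refl , eq
  ... | false with x , x∈ , px ← any⁻ xs h = x , there x∈ , px

  any-false⁻ : ∀ {x xs} → any p xs ≡ false → x ∈ xs → p x ≡ false
  any-false⁻ h x∈ = ¬-not λ px → not-¬ h (any⁺ x∈ px)

  any-false⁺ : ∀ xs → (∀ {x} → x ∈ xs → p x ≡ false) → any p xs ≡ false
  any-false⁺ xs h = ¬-not λ e → let x , x∈ , px = any⁻ xs e in not-¬ (h x∈) px

  ∈-filterᵇ⁺ : ∀ {x xs} → x ∈ xs → p x ≡ true → x ∈ filterᵇ p xs
  ∈-filterᵇ⁺ x∈ px = ∈-filter⁺ (T? ∘ p) x∈ (Equivalence.from T-≡ px)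

  ∈-filterᵇ⁻ : ∀ {x xs} → x ∈ filterᵇ p xs → x ∈ xs × p x ≡ true
  ∈-filterᵇ⁻ {xs = xs} x∈ with y , t ← ∈-filter⁻ (T? ∘ p) {xs = xs} x∈ = y , Equivalence.to T-≡ t

  filterᵇ-⊑ : ∀ xs → filterᵇ p xs ⊑ xs
  filterᵇ-⊑ = filter-⊆ (T? ∘ p)

  filterᵇ-mono-⊑ : ∀ {xs ys} → xs ⊑ ys → filterᵇ p xs ⊑ filterᵇ p ys
  filterᵇ-mono-⊑ [] = []
  filterᵇ-mono-⊑ (y ∷ʳ τ) with p y
  ... | true  = y ∷ʳ filterᵇ-mono-⊑ τ
  ... | false = filterᵇ-mono-⊑ τ
  filterᵇ-mono-⊑ (_∷_ {x = x} refl τ) with p x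
  ... | true  = refl ∷ filterᵇ-mono-⊑ τ
  ... | false = filterᵇ-mono-⊑ τ

filterᵇ-⇒-⊑ : ∀ {A : Set} {p q : A → Bool} xs → (∀ {x} → x ∈ xs → p x ≡ true → q x ≡ true) →
              filterᵇ p xs ⊑ filterᵇ q xs
filterᵇ-⇒-⊑ [] h = []
filterᵇ-⇒-⊑ {p = p} {q} (x ∷ xs) h with p x in px | q x in qx
... | true  | true  = refl ∷ filterᵇ-⇒-⊑ xs (h ∘ there)
... | true  | false = ⊥-elim (not-¬ qx (h (here refl) px))
... | false | true  = x ∷ʳ filterᵇ-⇒-⊑ xs (h ∘ there)
... | false | false = filterᵇ-⇒-⊑ xs (h ∘ there)

not-true⁻ : ∀ {b} → not b ≡ true → b ≡ false
not-true⁻ {false} _ = refl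

∧-true⁻ : ∀ {a b} → a ∧ b ≡ true → a ≡ true × b ≡ true
∧-true⁻ {true} e = refl , e

∨-false⁻ : ∀ {a b} → a ∨ b ≡ false → a ≡ false × b ≡ false
∨-false⁻ {false} e = refl , e

≤ᵇ-true : ∀ {m n} → m ≤ n → (m ≤ᵇ n) ≡ true
≤ᵇ-true m≤n = Equivalence.to T-≡ (≤⇒≤ᵇ m≤n)

≤ᵇ-true⁻ : ∀ {m n} → (m ≤ᵇ n) ≡ true → m ≤ n
≤ᵇ-true⁻ {m} {n} e = ≤ᵇ⇒≤ m n (Equivalence.from T-≡ e)

module Algorithm {n} (G : Graph n) where

  memb : Fin n → List (Fin n) → Bool
  memb u = any (λ w → does (u Fin.≟ w))

  memb⁺ : ∀ {u L} → u ∈ L → memb u L ≡ true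
  memb⁺ {u} u∈L = any⁺ u∈L (dec-true (u Fin.≟ u) refl)

  memb⁻ : ∀ {u} L → memb u L ≡ true → u ∈ L
  memb⁻ {u} L h with any⁻ L h
  ... | w , w∈L , e with u Fin.≟ w
  ...   | yes refl = w∈L

  memb-false⁻ : ∀ {u L} → memb u L ≡ false → ¬ u ∈ L
  memb-false⁻ h u∈L = not-¬ h (memb⁺ u∈L)

  adjAny : Fin n → List (Fin n) → Bool
  adjAny u = any (adj G u)

  nonNbrs : Fin n → List (Fin n) → List (Fin n)
  nonNbrs x = filterᵇ (λ y → not (adj G x y))

  missing : List (Fin n) → ℕ
  missing []       = 0
  missing (x ∷ xs) = length (nonNbrs x xs) + missing xs

  missing-mono : ∀ {xs ys} → xs ⊑ ys → missing xs ≤ missing ys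
  missing-mono []         = z≤n
  missing-mono (y ∷ʳ τ)   = ≤-trans (missing-mono τ) (m≤n+m _ _)
  missing-mono (refl ∷ τ) = +-mono-≤ (length-mono-≤ (filterᵇ-mono-⊑ τ)) (missing-mono τ)

  -- Independent sets and their number

  indepFrom : Fin n → List (Fin n) → Bool
  indepFrom x A = not (adjAny x A)

  extend : Fin n → List (List (Fin n)) → List (List (Fin n))
  extend x L = map (x ∷_) (filterᵇ (indepFrom x) L) ++ L

  indepSets : List (Fin n) → List (List (Fin n))
  indepSets []      = [] ∷ []
  indepSets (x ∷ D) = extend x (indepSets D)

  length-extend : ∀ x L → length (extend x L) ≡ length (filterᵇ (indepFrom x) L) + length L
  length-extend x L = begin
    length (extend x L)                                         ≡⟨ length-++ (map (x ∷_) (filterᵇ (indepFrom x) L)) ⟩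
    length (map (x ∷_) (filterᵇ (indepFrom x) L)) + length L    ≡⟨ cong (_+ length L) (length-map (x ∷_) (filterᵇ (indepFrom x) L)) ⟩
    length (filterᵇ (indepFrom x) L) + length L                 ∎
    where open ≡-Reasoning

  filter-comm-map : ∀ x y L → adj G x y ≡ false →
    filterᵇ (indepFrom x) (map (y ∷_) (filterᵇ (indepFrom y) L)) ≡
    map (y ∷_) (filterᵇ (indepFrom y) (filterᵇ (indepFrom x) L))
  filter-comm-map x y [] e = refl
  filter-comm-map x y (A ∷ L) e with adjAny y A in ya
  ... | false rewrite e with adjAny x A
  ...   | false rewrite ya = cong ((y ∷ A) ∷_) (filter-comm-map x y L e)
  ...   | true  = filter-comm-map x y L e
  filter-comm-map x y (A ∷ L) e | true with adjAny x A
  ...   | false rewrite ya = filter-comm-map x y L e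
  ...   | true  = filter-comm-map x y L e

  filter-map-adj : ∀ x y L → adj G x y ≡ true → filterᵇ (indepFrom x) (map (y ∷_) L) ≡ []
  filter-map-adj x y [] e = refl
  filter-map-adj x y (A ∷ L) e rewrite e = filter-map-adj x y L e

  filter-indepSets : ∀ x D → filterᵇ (indepFrom x) (indepSets D) ≡ indepSets (nonNbrs x D)
  filter-indepSets x [] = refl
  filter-indepSets x (y ∷ D)
    rewrite filter-++ (T? ∘ indepFrom x) (map (y ∷_) (filterᵇ (indepFrom y) (indepSets D))) (indepSets D)
    with adj G x y in e
  ... | true  rewrite filter-map-adj x y (filterᵇ (indepFrom y) (indepSets D)) e = filter-indepSets x D
  ... | false rewrite filter-comm-map x y (indepSets D) e | filter-indepSets x D = refl

  length-indepSets-∷ : ∀ x D → length (indepSets (x ∷ D)) ≡ length (indepSets (nonNbrs x D)) + length (indepSets D)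
  length-indepSets-∷ x D =
    trans (length-extend x (indepSets D)) (cong (λ L → length L + length (indepSets D)) (filter-indepSets x D))

  length-indepSets-∷-≤ : ∀ x D → length (indepSets (x ∷ D)) ≤ 2 * length (indepSets D)
  length-indepSets-∷-≤ x D = begin
    length (indepSets (x ∷ D))  ≡⟨ length-extend x (indepSets D) ⟩
    length (filterᵇ (indepFrom x) (indepSets D)) + length (indepSets D)
      ≤⟨ +-monoˡ-≤ _ (length-mono-≤ (filterᵇ-⊑ {p = indepFrom x} (indepSets D))) ⟩
    length (indepSets D) + length (indepSets D) ≡⟨ cong (length (indepSets D) +_) (sym (+-identityʳ _)) ⟩
    2 * length (indepSets D)    ∎
    where open ≤-Reasoning

  length-indepSets-suffix : ∀ x D → length (indepSets D) ≤ length (indepSets (x ∷ D))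
  length-indepSets-suffix x D rewrite length-indepSets-∷ x D = m≤n+m _ _

  length-indepSets-exp : ∀ D → length (indepSets D) ≤ 2 ^ length D
  length-indepSets-exp []      = ≤-refl
  length-indepSets-exp (x ∷ D) = ≤-trans (length-indepSets-∷-≤ x D) (*-monoʳ-≤ 2 (length-indepSets-exp D))

  -- A vertex with more than s non-neighbours uses up s of the missing pairs
  -- and at most doubles the count; any other one adds at most 2 ^ s sets.
  length-indepSets-bound : ∀ s m j D → length D ≤ m → missing D ≤ j * s →
    length (indepSets D) ≤ 2 ^ j * (1 + length D * 2 ^ s)
  length-indepSets-bound s m j [] _ _ = *-mono-≤ (m^n>0 2 j) (s≤s z≤n)
  length-indepSets-bound s (suc m) j (x ∷ D) (s≤s le) miss
    with length (nonNbrs x D) ≤? s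
  ... | yes d≤s = begin
    length (indepSets (x ∷ D)) ≡⟨ length-indepSets-∷ x D ⟩
    length (indepSets (nonNbrs x D)) + length (indepSets D)
      ≤⟨ +-mono-≤ (≤-trans (length-indepSets-exp (nonNbrs x D)) (^-monoʳ-≤ 2 d≤s))
                  (length-indepSets-bound s m j D le (≤-trans (m≤n+m _ _) miss)) ⟩
    2 ^ s + 2 ^ j * (1 + length D * 2 ^ s)
      ≤⟨ +-monoˡ-≤ _ (≤-trans (≤-reflexive (sym (*-identityˡ _))) (*-monoˡ-≤ (2 ^ s) (m^n>0 2 j))) ⟩
    2 ^ j * 2 ^ s + 2 ^ j * (1 + length D * 2 ^ s)
      ≡⟨ arrange (2 ^ j) (2 ^ s) (length D) ⟩
    2 ^ j * (1 + length (x ∷ D) * 2 ^ s) ∎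
    where
      open ≤-Reasoning
      arrange : ∀ a b l → a * b + a * (1 + l * b) ≡ a * (1 + suc l * b)
      arrange = solve-∀
  length-indepSets-bound s (suc m) zero (x ∷ D) (s≤s le) miss | no d≰s =
    ⊥-elim (d≰s (≤-trans (m≤m+n _ _) (≤-trans miss z≤n)))
  length-indepSets-bound s (suc m) (suc j) (x ∷ D) (s≤s le) miss | no d≰s = begin
    length (indepSets (x ∷ D)) ≡⟨ length-indepSets-∷ x D ⟩
    length (indepSets (nonNbrs x D)) + length (indepSets D)
      -- Recursion is on `m`, since `nonNbrs x D` is not a subterm of the list. It is a sublist of
      -- `D`, so both branches fit the reduced budget `j`.
      ≤⟨ +-mono-≤ (≤-trans (length-indepSets-bound s m j (nonNbrs x D) (≤-trans nbrs≤ le)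
                             (≤-trans (missing-mono (filterᵇ-⊑ D)) miss′))
                           (*-monoʳ-≤ (2 ^ j) (s≤s (*-monoˡ-≤ (2 ^ s) nbrs≤))))
                  (length-indepSets-bound s m j D le miss′) ⟩
    2 ^ j * (1 + length D * 2 ^ s) + 2 ^ j * (1 + length D * 2 ^ s)
      ≡⟨ arrange (2 ^ j) (1 + length D * 2 ^ s) ⟩
    2 ^ suc j * (1 + length D * 2 ^ s)
      ≤⟨ *-monoʳ-≤ (2 ^ suc j) (s≤s (m≤n+m _ (2 ^ s))) ⟩
    2 ^ suc j * (1 + length (x ∷ D) * 2 ^ s) ∎
    where
      open ≤-Reasoning
      nbrs≤ : length (nonNbrs x D) ≤ length D
      nbrs≤ = length-mono-≤ (filterᵇ-⊑ D)
      miss′ : missing D ≤ j * s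
      miss′ = +-cancelˡ-≤ s _ _ (≤-trans (+-monoˡ-≤ (missing D) (<⇒≤ (≰⇒> d≰s))) miss)
      arrange : ∀ a b → a * b + a * b ≡ (2 * a) * b
      arrange = solve-∀

  indepSets-⊆ : ∀ D {A u} → A ∈ indepSets D → u ∈ A → u ∈ D
  indepSets-⊆ [] (here refl) ()
  indepSets-⊆ (x ∷ D) A∈ u∈A with ∈-++⁻ (map (x ∷_) (filterᵇ (indepFrom x) (indepSets D))) A∈
  ... | inj₂ A∈′ = there (indepSets-⊆ D A∈′ u∈A)
  ... | inj₁ A∈′ with B , B∈ , refl ← ∈-map⁻ (x ∷_) A∈′ with u∈A
  ...   | here refl = here refl
  ...   | there u∈B = there (indepSets-⊆ D (proj₁ (∈-filterᵇ⁻ {p = indepFrom x} {xs = indepSets D} B∈)) u∈B)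

  indepSets-indep : ∀ D {A u w} → A ∈ indepSets D → u ∈ A → w ∈ A → adj G u w ≡ false
  indepSets-indep [] (here refl) ()
  indepSets-indep (x ∷ D) A∈ u∈A w∈A with ∈-++⁻ (map (x ∷_) (filterᵇ (indepFrom x) (indepSets D))) A∈
  ... | inj₂ A∈′ = indepSets-indep D A∈′ u∈A w∈A
  ... | inj₁ A∈′ with B , B∈ , refl ← ∈-map⁻ (x ∷_) A∈′ with B∈′ , xB ← ∈-filterᵇ⁻ {p = indepFrom x} {xs = indepSets D} B∈ with u∈A | w∈A
  ...   | here refl | here refl = Graph.irrefl G x
  ...   | here refl | there w∈B = any-false⁻ {p = adj G x} (not-true⁻ xB) w∈B
  ...   | there u∈B | here refl = trans (Graph.sym G _ x) (any-false⁻ {p = adj G x} (not-true⁻ xB) u∈B)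
  ...   | there u∈B | there w∈B = indepSets-indep D B∈′ u∈B w∈B

  filter∈indepSets : ∀ p D → (∀ {u w} → u ∈ D → w ∈ D → p u ≡ true → p w ≡ true → adj G u w ≡ false) →
                     filterᵇ p D ∈ indepSets D
  filter∈indepSets p [] h = here refl
  filter∈indepSets p (x ∷ D) h with p x in px | filter∈indepSets p D (λ u∈ w∈ → h (there u∈) (there w∈))
  ... | false | ih = ∈-++⁺ʳ _ ih
  ... | true  | ih = ∈-++⁺ˡ (∈-map⁺ (x ∷_) (∈-filterᵇ⁺ ih
    (cong not (any-false⁺ (filterᵇ p D) λ w∈ → let w∈D , pw = ∈-filterᵇ⁻ w∈ in h (here refl) (there w∈D) px pw))))

  -- Iterative compression

  allowed : List (Fin n) → Fin n → Bool
  allowed X u = not (memb u X ∨ adjAny u X)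

  -- True means the new clique side. `D` is the old clique side with the new vertex and `A` the part
  -- of it that leaves; a formerly independent vertex is called in only by a neighbour in `A`.
  exchange : List (Fin n) → List (Fin n) → Fin n → Bool
  exchange A D u = not (memb u A) ∧ (memb u D ∨ adjAny u A)

  choose : ℕ → List (Fin n) → Maybe (List (Fin n)) → Maybe (List (Fin n))
  choose k C r = if missing C ≤ᵇ k then just C else r

  search : ℕ → List (List (Fin n)) → List (Fin n) → List (Fin n) → Maybe (List (Fin n))
  search k []      D W = nothing
  search k (A ∷ S) D W = choose k (filterᵇ (exchange A D) W) (search k S D W)

  -- Only allowed vertices may leave the clique side, so the candidates come from the filtered list.
  -- `search` still receives all of `D`, which keeps the forbidden vertices on the clique side.
  step : ℕ → List (Fin n) → List (Fin n) → List (Fin n) → Maybe (List (Fin n))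
  step k X D W = search k (indepSets (filterᵇ (allowed X) D)) D W

  -- Iterative compression: the state is the clique side C of a partition of
  -- the vertices seen so far with at most k missing pairs in C.
  solve : ℕ → List (Fin n) → List (Fin n) → Maybe (List (Fin n))
  solve k X []      = just []
  solve k X (v ∷ W) with solve k X W
  ... | nothing = nothing
  ... | just C  = step k X (v ∷ C) (v ∷ W)

  search-just : ∀ k S D W {C} → search k S D W ≡ just C →
                ∃[ A ] A ∈ S × C ≡ filterᵇ (exchange A D) W × missing C ≤ k
  search-just k (A ∷ S) D W e with missing (filterᵇ (exchange A D) W) ≤ᵇ k in le
  search-just k (A ∷ S) D W refl | true = A , here refl , refl , ≤ᵇ-true⁻ le
  ... | false with B , B∈ , rest ← search-just k S D W e = B , there B∈ , rest

  search-nothing : ∀ k S D W → search k S D W ≡ nothing → ∀ {A} → A ∈ S →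
                   ¬ missing (filterᵇ (exchange A D) W) ≤ k
  search-nothing k (A ∷ S) D W e A∈ le with missing (filterᵇ (exchange A D) W) ≤ᵇ k in eq
  search-nothing k (A ∷ S) D W e (here refl) le | false = not-¬ eq (≤ᵇ-true le)
  search-nothing k (A ∷ S) D W e (there B∈) le  | false = search-nothing k S D W e B∈ le

  -- `q` is true on the clique side. That side carries no condition here, because its defects are
  -- what `missing` counts.
  record Valid (X W : List (Fin n)) (q : Fin n → Bool) : Set where
    field
      independent : ∀ {u w} → u ∈ W → w ∈ W → q u ≡ false → q w ≡ false → adj G u w ≡ false
      permitted   : ∀ {u} → u ∈ W → q u ≡ false → allowed X u ≡ true

  open Valid

  data ExchangeFalse (A D : List (Fin n)) (u : Fin n) : Set where
    chosen : u ∈ A → ExchangeFalse A D u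
    kept   : ¬ u ∈ D → (∀ {a} → a ∈ A → adj G u a ≡ false) → ExchangeFalse A D u

  exchange-false⁻ : ∀ {A D u} → exchange A D u ≡ false → ExchangeFalse A D u
  exchange-false⁻ {A} {D} {u} e with memb u A in uA
  ... | true = chosen (memb⁻ A uA)
  ... | false with memb u D in uD
  ...   | false = kept (memb-false⁻ uD) (any-false⁻ e)

  -- Two vertices of the new independent side are both in `A`, both old, or one of each; the last
  -- case is safe because old ones are kept only without neighbours in `A`. The bound on `missing`
  -- serves twice: for correctness, and to limit the number of candidate sets in the next step.
  solve-sound : ∀ k X W {C} → solve k X W ≡ just C →
                ∃[ q ] C ≡ filterᵇ q W × Valid X W q × missing C ≤ k
  solve-sound k X [] refl = (λ _ → true) , refl , record { independent = λ () ; permitted = λ () } , z≤n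
  solve-sound k X (v ∷ W) e with solve k X W in e₀
  ... | just C₀ with q₀ , refl , val , _ ← solve-sound k X W e₀
                with A , A∈ , refl , le ← search-just k (indepSets (filterᵇ (allowed X) (v ∷ C₀))) (v ∷ C₀) (v ∷ W) e
    = exchange A (v ∷ C₀) , refl , record { independent = ind ; permitted = per } , le
    where
      D = filterᵇ (allowed X) (v ∷ filterᵇ q₀ W)

      q₀-false : ∀ {u} → u ∈ v ∷ W → ¬ u ∈ v ∷ filterᵇ q₀ W → u ∈ W × q₀ u ≡ false
      q₀-false (here refl) u∉ = ⊥-elim (u∉ (here refl))
      q₀-false (there u∈W) u∉ = u∈W , ¬-not λ qu → u∉ (there (∈-filterᵇ⁺ u∈W qu))

      ind : ∀ {u w} → u ∈ v ∷ W → w ∈ v ∷ W → exchange A (v ∷ filterᵇ q₀ W) u ≡ false →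
            exchange A (v ∷ filterᵇ q₀ W) w ≡ false → adj G u w ≡ false
      ind u∈ w∈ qu qw with exchange-false⁻ {A} {v ∷ filterᵇ q₀ W} qu | exchange-false⁻ {A} {v ∷ filterᵇ q₀ W} qw
      ... | chosen u∈A  | chosen w∈A  = indepSets-indep D A∈ u∈A w∈A
      ... | chosen u∈A  | kept _ wA   = trans (Graph.sym G _ _) (wA u∈A)
      ... | kept _ uA   | chosen w∈A  = uA w∈A
      ... | kept u∉ _   | kept w∉ _   with u∈W , qu′ ← q₀-false u∈ u∉ | w∈W , qw′ ← q₀-false w∈ w∉
        = independent val u∈W w∈W qu′ qw′

      per : ∀ {u} → u ∈ v ∷ W → exchange A (v ∷ filterᵇ q₀ W) u ≡ false → allowed X u ≡ true
      per u∈ qu with exchange-false⁻ {A} {v ∷ filterᵇ q₀ W} qu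
      ... | chosen u∈A = proj₂ (∈-filterᵇ⁻ {p = allowed X} {xs = v ∷ filterᵇ q₀ W} (indepSets-⊆ D A∈ u∈A))
      ... | kept u∉ _ with u∈W , qu′ ← q₀-false u∈ u∉ = permitted val u∈W qu′

  -- A solution restricts to fewer vertices, so an earlier failure is final. Otherwise the part `A`
  -- of `D` that `q` makes independent is among the candidates. With it `exchange` yields a clique
  -- side inside that of `q`: an allowed vertex of `D₀` outside `A` is on the clique side of `q` by
  -- definition of `A`, and a vertex with a neighbour in `A` cannot be independent.
  solve-complete : ∀ k X W → solve k X W ≡ nothing → ∀ {q} → Valid X W q → ¬ missing (filterᵇ q W) ≤ k
  solve-complete k X (v ∷ W) e {q} val le with solve k X W in e₀
  ... | nothing = solve-complete k X W e₀
    (record { independent = λ u∈ w∈ → independent val (there u∈) (there w∈) ; permitted = permitted val ∘ there })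
    (≤-trans (missing-mono (filterᵇ-mono-⊑ {p = q} (v ∷ʳ ⊑-refl {x = W}))) le)
  ... | just C₀ with q₀ , refl , _ , _ ← solve-sound k X W e₀
    = search-nothing k (indepSets D) D₀ (v ∷ W) e A∈ (≤-trans (missing-mono (filterᵇ-⇒-⊑ (v ∷ W) incl)) le)
    where
      D₀ = v ∷ filterᵇ q₀ W
      D  = filterᵇ (allowed X) D₀
      A  = filterᵇ (not ∘ q) D

      D₀⊆ : ∀ {u} → u ∈ D₀ → u ∈ v ∷ W
      D₀⊆ (here refl) = here refl
      D₀⊆ (there u∈)  = there (proj₁ (∈-filterᵇ⁻ u∈))

      D⊆ : ∀ {u} → u ∈ D → u ∈ v ∷ W
      D⊆ u∈ = D₀⊆ (proj₁ (∈-filterᵇ⁻ {p = allowed X} {xs = D₀} u∈))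

      A∈ : A ∈ indepSets D
      A∈ = filter∈indepSets (not ∘ q) D λ u∈ w∈ qu qw →
        independent val (D⊆ u∈) (D⊆ w∈) (not-true⁻ qu) (not-true⁻ qw)

      incl : ∀ {u} → u ∈ v ∷ W → exchange A D₀ u ≡ true → q u ≡ true
      incl {u} u∈ ex = ¬-not absurd
        where
          absurd : ¬ q u ≡ false
          absurd qu with memb u A in uA
          absurd qu | false with memb u D₀ in uD
          ... | true  = memb-false⁻ {u} {A} uA (∈-filterᵇ⁺ {p = not ∘ q} (∈-filterᵇ⁺ {p = allowed X} (memb⁻ D₀ uD) (permitted val u∈ qu)) (cong not qu))
          ... | false with a , a∈A , ua ← any⁻ A ex with a∈D , qa ← ∈-filterᵇ⁻ {xs = D} a∈A
            = not-¬ (independent val u∈ (D⊆ a∈D) qu (not-true⁻ qa)) ua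

  solve-length : ∀ k X W {C} → solve k X W ≡ just C → length C ≤ length W
  solve-length k X W e with q , refl , _ ← solve-sound k X W e = length-mono-≤ (filterᵇ-⊑ {p = q} W)

  duplicate : List (Fin n) → Bool
  duplicate []      = false
  duplicate (x ∷ X) = memb x X ∨ duplicate X

  -- The non-adjacent pairs of the cycle `a b c d e`. The default `true` makes `check` reject lists
  -- with fewer than five vertices. The cycle edges are not tested, since a completion may add them.
  chord : List (Fin n) → Bool
  chord (a ∷ b ∷ c ∷ d ∷ e ∷ _) =
    adj G a c ∨ adj G b d ∨ adj G c e ∨ adj G a d ∨ adj G b e
  chord _ = true

  check : ℕ → List (Fin n) → List (Fin n) → Bool
  check k V X = not (duplicate X) ∧ not (chord X) ∧ is-just (solve k X V)

  guess : ℕ → ℕ → List (Fin n) → List (Fin n) → Bool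
  guess k zero    V X = check k V X
  guess k (suc d) V X = any (λ u → guess k d V (u ∷ X)) V

  -- The five chords of a guessed pentagon are counted as missing pairs.
  decide : ℕ → Bool
  decide k = is-just (solve k [] (allFin n)) ∨ guess (5 + k) 5 (allFin n) []

-- The program

pattern i0 = zero
pattern i1 = suc i0
pattern i2 = suc i1
pattern i3 = suc i2
pattern i4 = suc i3
pattern i5 = suc i4
pattern i6 = suc i5
pattern i7 = suc i6
pattern i8 = suc i7

pattern v0 = var i0
pattern v1 = var i1
pattern v2 = var i2
pattern v3 = var i3
pattern v4 = var i4
pattern v5 = var i5
pattern v6 = var i6
pattern v7 = var i7
pattern v8 = var i8

pattern trueᵗ = nilᵗ ∙ᵗ nilᵗ

-- The comment above a term names its variables, from 0 upwards.

-- (a , b)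
dropᵗ : Term 2
dropᵗ = foldᵗ v0 v2 (caseᵗ v0 nilᵗ v1)

-- (u , v)
adjᵗ : Term 2
adjᵗ = caseᵗ v0 nilᵗ (caseᵗ v3 nilᵗ (caseᵗ (callᵗ dropᵗ (v0 ∷ v3 ∷ [])) nilᵗ v0))

-- (u , v)
eqᵗ : Term 2
eqᵗ = caseᵗ v0 nilᵗ (caseᵗ v3 nilᵗ
  (caseᵗ (callᵗ dropᵗ (v0 ∷ v2 ∷ [])) (caseᵗ (callᵗ dropᵗ (v2 ∷ v0 ∷ [])) trueᵗ nilᵗ) nilᵗ))

-- (u , L)
anyᵗ : Term 2 → Term 2
anyᵗ t = foldᵗ v1 nilᵗ (caseᵗ (callᵗ t (v4 ∷ v1 ∷ [])) v0 trueᵗ)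

membᵗ adjAnyᵗ : Term 2
membᵗ   = anyᵗ eqᵗ
adjAnyᵗ = anyᵗ adjᵗ

-- (X , L)
allowedᵗ : Term 2
allowedᵗ = foldᵗ v1 nilᵗ
  (caseᵗ (callᵗ membᵗ (v1 ∷ v4 ∷ [])) (caseᵗ (callᵗ adjAnyᵗ (v1 ∷ v4 ∷ [])) (v1 ∙ᵗ v0) v2) v2)

-- (x , L)
extendᵗ : Term 2
extendᵗ = foldᵗ v1 v2 (caseᵗ (callᵗ adjAnyᵗ (v4 ∷ v1 ∷ [])) ((v4 ∙ᵗ v1) ∙ᵗ v0) v2)

indepSetsᵗ : Term 1
indepSetsᵗ = foldᵗ v0 (nilᵗ ∙ᵗ nilᵗ) (callᵗ extendᵗ (v1 ∷ v0 ∷ []))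

-- (A , D , W)
exchangeᵗ : Term 3
exchangeᵗ = foldᵗ v2 nilᵗ
  (caseᵗ (callᵗ membᵗ (v1 ∷ v4 ∷ []))
    (caseᵗ (callᵗ membᵗ (v1 ∷ v5 ∷ []))
      (caseᵗ (callᵗ adjAnyᵗ (v1 ∷ v4 ∷ [])) v0 (v3 ∙ᵗ v2))
      (v3 ∙ᵗ v2))
    v2)

-- (x , L , m)
countᵗ : Term 3
countᵗ = foldᵗ v1 v3 (caseᵗ (callᵗ adjᵗ (v4 ∷ v1 ∷ [])) (nilᵗ ∙ᵗ v0) v2)

missingᵗ : Term 1
missingᵗ = foldᵗ v0 nilᵗ (callᵗ countᵗ (v1 ∷ v2 ∷ v0 ∷ []))

-- (k , C , r)
chooseᵗ : Term 3
chooseᵗ = caseᵗ (callᵗ dropᵗ (v0 ∷ callᵗ missingᵗ (v1 ∷ []) ∷ [])) (nilᵗ ∙ᵗ v1) v4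

-- (k , S , D , W)
searchᵗ : Term 4
searchᵗ = foldᵗ v1 nilᵗ
  (callᵗ chooseᵗ (v4 ∷ callᵗ exchangeᵗ (v1 ∷ v6 ∷ v7 ∷ []) ∷ v0 ∷ []))

-- (k , X , D , W)
stepᵗ : Term 4
stepᵗ = callᵗ searchᵗ (v0 ∷ callᵗ indepSetsᵗ (callᵗ allowedᵗ (v1 ∷ v2 ∷ []) ∷ []) ∷ v2 ∷ v3 ∷ [])

-- (k , X , V)
solveᵗ : Term 3
solveᵗ = foldᵗ v2 (nilᵗ ∙ᵗ nilᵗ)
  (caseᵗ v0 nilᵗ (callᵗ stepᵗ (v6 ∷ v7 ∷ (v3 ∙ᵗ v1) ∷ v5 ∷ [])))

duplicateᵗ : Term 1
duplicateᵗ = foldᵗ v0 nilᵗ (caseᵗ (callᵗ membᵗ (v1 ∷ v2 ∷ [])) v0 trueᵗ)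

_∨ᵗ_ : ∀ {v} → Term v → Term v → Term v
a ∨ᵗ b = caseᵗ a b trueᵗ

infixr 6 _∨ᵗ_

chordᵗ : Term 1
chordᵗ = caseᵗ v0 trueᵗ (caseᵗ v1 trueᵗ (caseᵗ v1 trueᵗ (caseᵗ v1 trueᵗ (caseᵗ v1 trueᵗ
  (callᵗ adjᵗ (v8 ∷ v4 ∷ []) ∨ᵗ callᵗ adjᵗ (v6 ∷ v2 ∷ []) ∨ᵗ callᵗ adjᵗ (v4 ∷ v0 ∷ []) ∨ᵗ
   callᵗ adjᵗ (v8 ∷ v2 ∷ []) ∨ᵗ callᵗ adjᵗ (v6 ∷ v0 ∷ []))))))

-- (k , V , X)
checkᵗ : Term 3
checkᵗ = caseᵗ (callᵗ duplicateᵗ (v2 ∷ []))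
  (caseᵗ (callᵗ chordᵗ (v2 ∷ [])) (caseᵗ (callᵗ solveᵗ (v0 ∷ v2 ∷ v1 ∷ [])) nilᵗ trueᵗ) nilᵗ) nilᵗ

-- (k , V , X)
guessᵗ : ℕ → Term 3
guessᵗ zero    = checkᵗ
guessᵗ (suc d) = foldᵗ v1 nilᵗ (caseᵗ (callᵗ (guessᵗ d) (v4 ∷ v5 ∷ (v1 ∙ᵗ v6) ∷ [])) v0 trueᵗ)

-- The fold in `verticesᵗ` numbers the tail from 0; these numbers have to go up by one before a new
-- vertex 0 is put in front.
shiftᵗ : Term 1
shiftᵗ = foldᵗ v0 nilᵗ (caseᵗ v1 nilᵗ (((nilᵗ ∙ᵗ v0) ∙ᵗ v1) ∙ᵗ v2))

verticesᵗ : Term 1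
verticesᵗ = foldᵗ v0 nilᵗ ((nilᵗ ∙ᵗ v1) ∙ᵗ callᵗ shiftᵗ (v0 ∷ []))

-- (k , V)
decideᵗ : Term 2
decideᵗ = caseᵗ (callᵗ solveᵗ (v0 ∷ nilᵗ ∷ v1 ∷ []))
  (callᵗ (guessᵗ 5) ((nilᵗ ∙ᵗ nilᵗ ∙ᵗ nilᵗ ∙ᵗ nilᵗ ∙ᵗ nilᵗ ∙ᵗ v0) ∷ v1 ∷ nilᵗ ∷ [])) trueᵗ

mainᵗ : Term 1
mainᵗ = caseᵗ v0 nilᵗ (callᵗ decideᵗ (v1 ∷ callᵗ verticesᵗ (v0 ∷ []) ∷ []))

-- The program computes the algorithm

spine-encodeList : ∀ xs → spine (encodeList xs) ≡ length xs
spine-encodeList []       = refl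
spine-encodeList (x ∷ xs) = cong suc (spine-encodeList xs)

spine-encodeMap : ∀ {A : Set} (f : A → Tree) xs {Q} → length xs ≤ Q → spine (encodeList (map f xs)) ≤ Q
spine-encodeMap f xs le = ≤-trans (≤-reflexive (trans (spine-encodeList (map f xs)) (length-map f xs))) le

spine-encodeℕ : ∀ k {Q} → k ≤ Q → spine (encodeℕ k) ≤ Q
spine-encodeℕ k le = ≤-trans (≤-reflexive (trans (spine-encodeList _) (length-replicate k))) le

drop-suc : ∀ {A : Set} m (xs : List A) → drop (suc m) xs ≡ drop 1 (drop m xs)
drop-suc zero    xs       = refl
drop-suc (suc m) []       = refl
drop-suc (suc m) (x ∷ xs) = drop-suc m xs

drop-tabulate : ∀ {A : Set} {n} (f : Fin n → A) i → ∃[ xs ] drop (toℕ i) (tabulate f) ≡ f i ∷ xs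
drop-tabulate f zero    = _ , refl
drop-tabulate f (suc i) = drop-tabulate (f ∘ suc) i

drop-replicate : ∀ {A : Set} (x : A) m k → drop m (replicate k x) ≡ replicate (k ∸ m) x
drop-replicate x zero    k       = refl
drop-replicate x (suc m) zero    = refl
drop-replicate x (suc m) (suc k) = drop-replicate x m k

module Runs (Q : ℕ) {n} (G : Graph n) (n≤Q : n ≤ Q) where

  open Run Q
  open Algorithm G

  row : Fin n → Tree
  row i = encodeList (tabulate λ j → encodeBool (adj G i j))

  -- A vertex carries its adjacency row, so adjacency is tested from two vertices alone, without
  -- passing the matrix around.
  vertex : Fin n → Tree
  vertex i = encodeℕ (toℕ i) ∙ row i

  vertices : List (Fin n) → Tree
  vertices L = encodeList (map vertex L)

  sets : List (List (Fin n)) → Tree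
  sets S = encodeList (map vertices S)

  option : Maybe (List (Fin n)) → Tree
  option nothing  = nil
  option (just C) = nil ∙ vertices C

  ⇒-≡ : ∀ {v} {ρ : Vec Tree v} {t x y} → x ≡ y → ρ ⊨ t ⇒ x → ρ ⊨ t ⇒ y
  ⇒-≡ refl p = p

  drop-⇒ : ∀ m xs → m ≤ Q → encodeℕ m ∷ encodeList xs ∷ [] ⊨ dropᵗ ⇒ encodeList (drop m xs)
  drop-⇒ m xs m≤Q = ⇒fold ⇒var (spine-encodeℕ m m≤Q) (go m)
    where
      go : ∀ l → Loop (encodeℕ m ∷ encodeList xs ∷ []) v2 (caseᵗ v0 nilᵗ v1) (encodeℕ l) (encodeList (drop l xs))
      go zero    = loop-nil ⇒var
      go (suc l) rewrite drop-suc l xs with drop l xs | go l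
      ... | []     | p = loop-∙ p (⇒case-nil ⇒var ⇒nil)
      ... | _ ∷ _  | p = loop-∙ p (⇒case-∙ ⇒var ⇒var)

  -- Unary numbers are lists, so `dropᵗ` doubles as truncated subtraction; order and equality of
  -- numbers are tested by whether differences vanish.
  drop-encodeℕ-⇒ : ∀ m k → m ≤ Q → encodeℕ m ∷ encodeℕ k ∷ [] ⊨ dropᵗ ⇒ encodeℕ (k ∸ m)
  drop-encodeℕ-⇒ m k m≤Q = ⇒-≡ (cong encodeList (drop-replicate nil m k)) (drop-⇒ m _ m≤Q)

  toℕ≤Q : ∀ (i : Fin n) → toℕ i ≤ Q
  toℕ≤Q i = ≤-trans (<⇒≤ (Fin.toℕ<n i)) n≤Q

  adj-⇒ : ∀ u v → vertex u ∷ vertex v ∷ [] ⊨ adjᵗ ⇒ encodeBool (adj G u v)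
  adj-⇒ u v with xs , eq ← drop-tabulate (λ j → encodeBool (adj G u j)) v =
    ⇒case-∙ ⇒var (⇒case-∙ ⇒var (⇒case-∙
      (⇒call (⇒var ∷ ⇒var ∷ []) (⇒-≡ (cong encodeList eq) (drop-⇒ (toℕ v) _ (toℕ≤Q v))))
      ⇒var))

  eq-⇒ : ∀ u v → vertex u ∷ vertex v ∷ [] ⊨ eqᵗ ⇒ encodeBool (does (u Fin.≟ v))
  eq-⇒ u v with toℕ u ∸ toℕ v in uv | toℕ v ∸ toℕ u in vu
              | drop-encodeℕ-⇒ (toℕ v) (toℕ u) (toℕ≤Q v) | drop-encodeℕ-⇒ (toℕ u) (toℕ v) (toℕ≤Q u)
  ... | zero | zero | p | q
    rewrite dec-true (u Fin.≟ v) (Fin.toℕ-injective (≤-antisym (m∸n≡0⇒m≤n uv) (m∸n≡0⇒m≤n vu)))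
    = ⇒case-∙ ⇒var (⇒case-∙ ⇒var (⇒case-nil (⇒call (⇒var ∷ ⇒var ∷ []) p)
        (⇒case-nil (⇒call (⇒var ∷ ⇒var ∷ []) q) (⇒∙ ⇒nil ⇒nil))))
  ... | zero | suc _ | p | q
    rewrite dec-false (u Fin.≟ v) (λ { refl → 0≢1+n (trans (sym (n∸n≡0 (toℕ u))) vu) })
    = ⇒case-∙ ⇒var (⇒case-∙ ⇒var (⇒case-nil (⇒call (⇒var ∷ ⇒var ∷ []) p)
        (⇒case-∙ (⇒call (⇒var ∷ ⇒var ∷ []) q) ⇒nil)))
  ... | suc _ | _ | p | q
    rewrite dec-false (u Fin.≟ v) (λ { refl → 0≢1+n (trans (sym (n∸n≡0 (toℕ u))) uv) })
    = ⇒case-∙ ⇒var (⇒case-∙ ⇒var (⇒case-∙ (⇒call (⇒var ∷ ⇒var ∷ []) p) ⇒nil))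

  any-⇒ : ∀ {t} {p : Fin n → Fin n → Bool} →
    (∀ u v → vertex u ∷ vertex v ∷ [] ⊨ t ⇒ encodeBool (p u v)) →
    ∀ u L → length L ≤ Q → vertex u ∷ vertices L ∷ [] ⊨ anyᵗ t ⇒ encodeBool (any (p u) L)
  any-⇒ {t} {p} run u L le = ⇒fold ⇒var (spine-encodeMap vertex L le) (go L)
    where
      go : ∀ L′ → Loop (vertex u ∷ vertices L ∷ []) nilᵗ (caseᵗ (callᵗ t (v4 ∷ v1 ∷ [])) v0 trueᵗ)
                       (vertices L′) (encodeBool (any (p u) L′))
      go []      = loop-nil ⇒nil
      go (x ∷ L) with p u x | run u x
      ... | false | r = loop-∙ (go L) (⇒case-nil (⇒call (⇒var ∷ ⇒var ∷ []) r) ⇒var)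
      ... | true  | r = loop-∙ (go L) (⇒case-∙ (⇒call (⇒var ∷ ⇒var ∷ []) r) (⇒∙ ⇒nil ⇒nil))

  memb-⇒ : ∀ u L → length L ≤ Q → vertex u ∷ vertices L ∷ [] ⊨ membᵗ ⇒ encodeBool (memb u L)
  memb-⇒ = any-⇒ eq-⇒

  adjAny-⇒ : ∀ u L → length L ≤ Q → vertex u ∷ vertices L ∷ [] ⊨ adjAnyᵗ ⇒ encodeBool (adjAny u L)
  adjAny-⇒ = any-⇒ adj-⇒

  call₁ : ∀ {v} {ρ : Vec Tree v} {t : Term 1} {i z} →
          Vec.lookup ρ i ∷ [] ⊨ t ⇒ z → ρ ⊨ callᵗ t (var i ∷ []) ⇒ z
  call₁ = ⇒call (⇒var ∷ [])

  call₂ : ∀ {v} {ρ : Vec Tree v} {t : Term 2} {i j z} →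
          Vec.lookup ρ i ∷ Vec.lookup ρ j ∷ [] ⊨ t ⇒ z → ρ ⊨ callᵗ t (var i ∷ var j ∷ []) ⇒ z
  call₂ = ⇒call (⇒var ∷ ⇒var ∷ [])

  allowed-⇒ : ∀ X L → length X ≤ Q → length L ≤ Q →
    vertices X ∷ vertices L ∷ [] ⊨ allowedᵗ ⇒ vertices (filterᵇ (allowed X) L)
  allowed-⇒ X L leX leL = ⇒fold ⇒var (spine-encodeMap vertex L leL) (go L)
    where
      go : ∀ L′ → Loop (vertices X ∷ vertices L ∷ []) nilᵗ _ (vertices L′) (vertices (filterᵇ (allowed X) L′))
      go []      = loop-nil ⇒nil
      go (u ∷ L) with memb u X | memb-⇒ u X leX
      ... | true  | p = loop-∙ (go L) (⇒case-∙ (call₂ p) ⇒var)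
      ... | false | p with adjAny u X | adjAny-⇒ u X leX
      ...   | true  | q = loop-∙ (go L) (⇒case-nil (call₂ p) (⇒case-∙ (call₂ q) ⇒var))
      ...   | false | q = loop-∙ (go L) (⇒case-nil (call₂ p) (⇒case-nil (call₂ q) (⇒∙ ⇒var ⇒var)))

  extend-⇒ : ∀ x L → length L ≤ Q → (∀ {A} → A ∈ L → length A ≤ Q) →
    vertex x ∷ sets L ∷ [] ⊨ extendᵗ ⇒ sets (extend x L)
  extend-⇒ x L leL leA = ⇒fold ⇒var (spine-encodeMap vertices L leL) (go L leA)
    where
      go : ∀ S → (∀ {A} → A ∈ S → length A ≤ Q) → Loop (vertex x ∷ sets L ∷ []) v2 _ (sets S)
             (sets (map (x ∷_) (filterᵇ (indepFrom x) S) ++ L))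
      go []      le = loop-nil ⇒var
      go (A ∷ S) le with adjAny x A | adjAny-⇒ x A (le (here refl))
      ... | true  | p = loop-∙ (go S (le ∘ there)) (⇒case-∙ (call₂ p) ⇒var)
      ... | false | p = loop-∙ (go S (le ∘ there)) (⇒case-nil (call₂ p) (⇒∙ (⇒∙ ⇒var ⇒var) ⇒var))

  length-indepSets-∈ : ∀ D {A} → A ∈ indepSets D → length A ≤ length D
  length-indepSets-∈ [] (here refl) = z≤n
  length-indepSets-∈ (x ∷ D) A∈ with ∈-++⁻ (map (x ∷_) (filterᵇ (indepFrom x) (indepSets D))) A∈
  ... | inj₂ A∈′ = m≤n⇒m≤1+n (length-indepSets-∈ D A∈′)
  ... | inj₁ A∈′ with B , B∈ , refl ← ∈-map⁻ (x ∷_) A∈′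
    = s≤s (length-indepSets-∈ D (proj₁ (∈-filterᵇ⁻ {p = indepFrom x} {xs = indepSets D} B∈)))

  indepSets-⇒ : ∀ D → length D ≤ Q → length (indepSets D) ≤ Q →
    vertices D ∷ [] ⊨ indepSetsᵗ ⇒ sets (indepSets D)
  indepSets-⇒ D leD leS = ⇒fold ⇒var (spine-encodeMap vertex D leD) (go D leD leS)
    where
      go : ∀ D′ → length D′ ≤ Q → length (indepSets D′) ≤ Q →
           Loop (vertices D ∷ []) _ _ (vertices D′) (sets (indepSets D′))
      go []       _   _   = loop-nil (⇒∙ ⇒nil ⇒nil)
      go (x ∷ D′) leD leS = loop-∙ (go D′ leD′ leS′)
        (call₂ (extend-⇒ x (indepSets D′) leS′ λ A∈ → ≤-trans (length-indepSets-∈ D′ A∈) leD′))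
        where
          leD′ = ≤-trans (n≤1+n _) leD
          leS′ = ≤-trans (length-indepSets-suffix x D′) leS

  exchange-⇒ : ∀ A D W → length A ≤ Q → length D ≤ Q → length W ≤ Q →
    vertices A ∷ vertices D ∷ vertices W ∷ [] ⊨ exchangeᵗ ⇒ vertices (filterᵇ (exchange A D) W)
  exchange-⇒ A D W leA leD leW = ⇒fold ⇒var (spine-encodeMap vertex W leW) (go W)
    where
      go : ∀ W′ → Loop (vertices A ∷ vertices D ∷ vertices W ∷ []) nilᵗ _ (vertices W′)
                       (vertices (filterᵇ (exchange A D) W′))
      go []       = loop-nil ⇒nil
      go (u ∷ W′) with memb u A | memb-⇒ u A leA
      ... | true  | p = loop-∙ (go W′) (⇒case-∙ (call₂ p) ⇒var)
      ... | false | p with memb u D | memb-⇒ u D leD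
      ...   | true  | q = loop-∙ (go W′) (⇒case-nil (call₂ p) (⇒case-∙ (call₂ q) (⇒∙ ⇒var ⇒var)))
      ...   | false | q with adjAny u A | adjAny-⇒ u A leA
      ...     | false | r = loop-∙ (go W′) (⇒case-nil (call₂ p) (⇒case-nil (call₂ q) (⇒case-nil (call₂ r) ⇒var)))
      ...     | true  | r = loop-∙ (go W′) (⇒case-nil (call₂ p) (⇒case-nil (call₂ q)
                              (⇒case-∙ (call₂ r) (⇒∙ ⇒var ⇒var))))

  count-⇒ : ∀ x L m → length L ≤ Q →
    vertex x ∷ vertices L ∷ encodeℕ m ∷ [] ⊨ countᵗ ⇒ encodeℕ (length (nonNbrs x L) + m)
  count-⇒ x L m le = ⇒fold ⇒var (spine-encodeMap vertex L le) (go L)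
    where
      go : ∀ L′ → Loop (vertex x ∷ vertices L ∷ encodeℕ m ∷ []) v3 _ (vertices L′)
                       (encodeℕ (length (nonNbrs x L′) + m))
      go []       = loop-nil ⇒var
      go (y ∷ L′) with adj G x y | adj-⇒ x y
      ... | true  | p = loop-∙ (go L′) (⇒case-∙ (call₂ p) ⇒var)
      ... | false | p = loop-∙ (go L′) (⇒case-nil (call₂ p) (⇒∙ ⇒nil ⇒var))

  missing-⇒ : ∀ L → length L ≤ Q → vertices L ∷ [] ⊨ missingᵗ ⇒ encodeℕ (missing L)
  missing-⇒ L le = ⇒fold ⇒var (spine-encodeMap vertex L le) (go L le)
    where
      go : ∀ L′ → length L′ ≤ Q → Loop (vertices L ∷ []) nilᵗ _ (vertices L′) (encodeℕ (missing L′))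
      go []       le = loop-nil ⇒nil
      go (x ∷ L′) le = loop-∙ (go L′ le′) (⇒call (⇒var ∷ ⇒var ∷ ⇒var ∷ []) (count-⇒ x L′ _ le′))
        where le′ = ≤-trans (n≤1+n _) le

  choose-⇒ : ∀ k C r → k ≤ Q → length C ≤ Q →
    encodeℕ k ∷ vertices C ∷ option r ∷ [] ⊨ chooseᵗ ⇒ option (choose k C r)
  choose-⇒ k C r leK leC with drop-encodeℕ-⇒ k (missing C) leK
  ... | p with missing C ∸ k in eq
  ...   | zero rewrite ≤ᵇ-true (m∸n≡0⇒m≤n {missing C} {k} eq) =
    ⇒case-nil (⇒call (⇒var ∷ call₁ (missing-⇒ C leC) ∷ []) p) (⇒∙ ⇒nil ⇒var)
  ...   | suc _ with missing C ≤ᵇ k in le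
  ...     | true  = ⊥-elim (0≢1+n (trans (sym (m≤n⇒m∸n≡0 (≤ᵇ-true⁻ {missing C} {k} le))) eq))
  ...     | false = ⇒case-∙ (⇒call (⇒var ∷ call₁ (missing-⇒ C leC) ∷ []) p) ⇒var

  search-⇒ : ∀ k S D W → k ≤ Q → length S ≤ Q → (∀ {A} → A ∈ S → length A ≤ Q) → length D ≤ Q → length W ≤ Q →
    encodeℕ k ∷ sets S ∷ vertices D ∷ vertices W ∷ [] ⊨ searchᵗ ⇒ option (search k S D W)
  search-⇒ k S D W leK leS leA leD leW = ⇒fold ⇒var (spine-encodeMap vertices S leS) (go S leA)
    where
      go : ∀ S′ → (∀ {A} → A ∈ S′ → length A ≤ Q) →
           Loop (encodeℕ k ∷ sets S ∷ vertices D ∷ vertices W ∷ []) nilᵗ _ (sets S′) (option (search k S′ D W))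
      go []       le = loop-nil ⇒nil
      go (A ∷ S′) le = loop-∙ (go S′ (le ∘ there))
        (⇒call (⇒var ∷ ⇒call (⇒var ∷ ⇒var ∷ ⇒var ∷ []) (exchange-⇒ A D W (le (here refl)) leD leW) ∷ ⇒var ∷ [])
          (choose-⇒ k (filterᵇ (exchange A D) W) (search k S′ D W) leK
            (≤-trans (length-mono-≤ (filterᵇ-⊑ {p = exchange A D} W)) leW)))

  step-⇒ : ∀ k X D W → k ≤ Q → length X ≤ Q → length D ≤ Q → length W ≤ Q →
    length (indepSets (filterᵇ (allowed X) D)) ≤ Q →
    encodeℕ k ∷ vertices X ∷ vertices D ∷ vertices W ∷ [] ⊨ stepᵗ ⇒ option (step k X D W)
  step-⇒ k X D W leK leX leD leW leS =
    ⇒call (⇒var ∷ ⇒call (call₂ (allowed-⇒ X D leX leD) ∷ []) (indepSets-⇒ D′ leD′ leS) ∷ ⇒var ∷ ⇒var ∷ [])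
      (search-⇒ k (indepSets D′) D W leK leS (λ A∈ → ≤-trans (length-indepSets-∈ D′ A∈) leD′) leD leW)
    where
      D′   = filterᵇ (allowed X) D
      leD′ = ≤-trans (length-mono-≤ (filterᵇ-⊑ {p = allowed X} D)) leD

  module _ (k : ℕ) (leK : k ≤ Q)
           (few : ∀ X v C → missing C ≤ k → length C ≤ n → length (indepSets (filterᵇ (allowed X) (v ∷ C))) ≤ Q) where

    -- The only length that needs an argument is that of the candidate list. The hypothesis `few`
    -- bounds it, and the bound on `missing` that `few` asks for comes from the invariant
    -- `solve-sound`.
    solve-⇒ : ∀ X V → length X ≤ Q → length V ≤ n →
      encodeℕ k ∷ vertices X ∷ vertices V ∷ [] ⊨ solveᵗ ⇒ option (solve k X V)
    solve-⇒ X V leX leV = ⇒fold ⇒var (spine-encodeMap vertex V (≤-trans leV n≤Q)) (go V leV)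
      where
        go : ∀ W → length W ≤ n → Loop (encodeℕ k ∷ vertices X ∷ vertices V ∷ []) _ _ (vertices W) (option (solve k X W))
        go []      le = loop-nil (⇒∙ ⇒nil ⇒nil)
        go (v ∷ W) le with go W (≤-trans (n≤1+n _) le)
        ... | p with solve k X W in eq
        ...   | nothing = loop-∙ p (⇒case-nil ⇒var ⇒nil)
        ...   | just C with _ , _ , _ , miss ← solve-sound k X W eq =
          loop-∙ p (⇒case-∙ ⇒var (⇒call (⇒var ∷ ⇒var ∷ ⇒∙ ⇒var ⇒var ∷ ⇒var ∷ [])
            (step-⇒ k X (v ∷ C) (v ∷ W) leK leX (≤-trans lenC (≤-trans le n≤Q)) (≤-trans le n≤Q)
              (few X v C miss (≤-trans (n≤1+n _) (≤-trans lenC le))))))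
          where
            lenC : length (v ∷ C) ≤ length (v ∷ W)
            lenC = s≤s (solve-length k X W eq)

    duplicate-⇒ : ∀ X → length X ≤ Q → vertices X ∷ [] ⊨ duplicateᵗ ⇒ encodeBool (duplicate X)
    duplicate-⇒ X le = ⇒fold ⇒var (spine-encodeMap vertex X le) (go X le)
      where
        go : ∀ X′ → length X′ ≤ Q → Loop (vertices X ∷ []) nilᵗ _ (vertices X′) (encodeBool (duplicate X′))
        go []       le = loop-nil ⇒nil
        go (x ∷ X′) le with memb x X′ | memb-⇒ x X′ (≤-trans (n≤1+n _) le)
        ... | true  | p = loop-∙ (go X′ (≤-trans (n≤1+n _) le)) (⇒case-∙ (call₂ p) (⇒∙ ⇒nil ⇒nil))
        ... | false | p = loop-∙ (go X′ (≤-trans (n≤1+n _) le)) (⇒case-nil (call₂ p) ⇒var)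

    or-⇒ : ∀ {v} {ρ : Vec Tree v} {s t} {a b : Bool} → ρ ⊨ s ⇒ encodeBool a → ρ ⊨ t ⇒ encodeBool b →
           ρ ⊨ s ∨ᵗ t ⇒ encodeBool (a ∨ b)
    or-⇒ {a = false} p q = ⇒case-nil p q
    or-⇒ {a = true}  p q = ⇒case-∙ p (⇒∙ ⇒nil ⇒nil)

    chord-⇒ : ∀ X → vertices X ∷ [] ⊨ chordᵗ ⇒ encodeBool (chord X)
    chord-⇒ [] = ⇒case-nil ⇒var (⇒∙ ⇒nil ⇒nil)
    chord-⇒ (_ ∷ []) = ⇒case-∙ ⇒var (⇒case-nil ⇒var (⇒∙ ⇒nil ⇒nil))
    chord-⇒ (_ ∷ _ ∷ []) = ⇒case-∙ ⇒var (⇒case-∙ ⇒var (⇒case-nil ⇒var (⇒∙ ⇒nil ⇒nil)))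
    chord-⇒ (_ ∷ _ ∷ _ ∷ []) = ⇒case-∙ ⇒var (⇒case-∙ ⇒var (⇒case-∙ ⇒var (⇒case-nil ⇒var (⇒∙ ⇒nil ⇒nil))))
    chord-⇒ (_ ∷ _ ∷ _ ∷ _ ∷ []) =
      ⇒case-∙ ⇒var (⇒case-∙ ⇒var (⇒case-∙ ⇒var (⇒case-∙ ⇒var (⇒case-nil ⇒var (⇒∙ ⇒nil ⇒nil)))))
    chord-⇒ (a ∷ b ∷ c ∷ d ∷ e ∷ X) =
      ⇒case-∙ ⇒var (⇒case-∙ ⇒var (⇒case-∙ ⇒var (⇒case-∙ ⇒var (⇒case-∙ ⇒var
        (or-⇒ {a = adj G a c} (call₂ (adj-⇒ a c)) (or-⇒ {a = adj G b d} (call₂ (adj-⇒ b d))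
          (or-⇒ {a = adj G c e} (call₂ (adj-⇒ c e)) (or-⇒ {a = adj G a d} (call₂ (adj-⇒ a d))
            (call₂ (adj-⇒ b e))))))))))

    check-⇒ : ∀ V X → length X ≤ Q → length V ≤ n →
      encodeℕ k ∷ vertices V ∷ vertices X ∷ [] ⊨ checkᵗ ⇒ encodeBool (check k V X)
    check-⇒ V X leX leV with duplicate X | duplicate-⇒ X leX
    ... | true  | p = ⇒case-∙ (call₁ p) ⇒nil
    ... | false | p with chord X | chord-⇒ X
    ...   | true  | q = ⇒case-nil (call₁ p) (⇒case-∙ (call₁ q) ⇒nil)
    ...   | false | q with solve k X V | solve-⇒ X V leX leV
    ...     | nothing | r = ⇒case-nil (call₁ p) (⇒case-nil (call₁ q) (⇒case-nil (⇒call (⇒var ∷ ⇒var ∷ ⇒var ∷ []) r) ⇒nil))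
    ...     | just _  | r = ⇒case-nil (call₁ p) (⇒case-nil (call₁ q) (⇒case-∙ (⇒call (⇒var ∷ ⇒var ∷ ⇒var ∷ []) r) (⇒∙ ⇒nil ⇒nil)))

    guess-⇒ : ∀ d V X → d + length X ≤ Q → length V ≤ n →
      encodeℕ k ∷ vertices V ∷ vertices X ∷ [] ⊨ guessᵗ d ⇒ encodeBool (guess k d V X)
    guess-⇒ zero    V X leX leV = check-⇒ V X leX leV
    guess-⇒ (suc d) V X leX leV = ⇒fold ⇒var (spine-encodeMap vertex V (≤-trans leV n≤Q)) (go V)
      where
        go : ∀ L → Loop (encodeℕ k ∷ vertices V ∷ vertices X ∷ []) nilᵗ _ (vertices L)
                        (encodeBool (any (λ u → guess k d V (u ∷ X)) L))
        go []      = loop-nil ⇒nil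
        go (u ∷ L) with guess k d V (u ∷ X) | guess-⇒ d V (u ∷ X) (≤-trans (≤-reflexive (+-suc d (length X))) leX) leV
        ... | false | r = loop-∙ (go L) (⇒case-nil (⇒call (⇒var ∷ ⇒var ∷ ⇒∙ ⇒var ⇒var ∷ []) r) ⇒var)
        ... | true  | r = loop-∙ (go L) (⇒case-∙ (⇒call (⇒var ∷ ⇒var ∷ ⇒∙ ⇒var ⇒var ∷ []) r) (⇒∙ ⇒nil ⇒nil))

  encodeList-tabulate-⇒ : ∀ m (f : Fin m → Tree) → m ≤ Q →
    encodeList (tabulate f) ∷ [] ⊨ verticesᵗ ⇒ encodeList (tabulate λ i → encodeℕ (toℕ i) ∙ f i)
  encodeList-tabulate-⇒ m f m≤Q = ⇒fold ⇒var (spine-tabulate f m≤Q) (go m f m≤Q)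
    where
      spine-tabulate : ∀ {m} (f : Fin m → Tree) → m ≤ Q → spine (encodeList (tabulate f)) ≤ Q
      spine-tabulate f le = ≤-trans (≤-reflexive (trans (spine-encodeList (tabulate f)) (length-tabulate f))) le

      shift-⇒ : ∀ {m} (g : Fin m → ℕ) (f : Fin m → Tree) → m ≤ Q →
        encodeList (tabulate λ i → encodeℕ (g i) ∙ f i) ∷ [] ⊨ shiftᵗ ⇒ encodeList (tabulate λ i → encodeℕ (suc (g i)) ∙ f i)
      shift-⇒ g f le = ⇒fold ⇒var (spine-tabulate (λ i → encodeℕ (g i) ∙ f i) le) (loop-shift g f)
        where
          loop-shift : ∀ {v m} {ρ : Vec Tree v} (g : Fin m → ℕ) (f : Fin m → Tree) →
            Loop ρ nilᵗ (caseᵗ v1 nilᵗ (((nilᵗ ∙ᵗ v0) ∙ᵗ v1) ∙ᵗ v2))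
              (encodeList (tabulate λ i → encodeℕ (g i) ∙ f i)) (encodeList (tabulate λ i → encodeℕ (suc (g i)) ∙ f i))
          loop-shift {m = zero}  g f = loop-nil ⇒nil
          loop-shift {m = suc m} g f = loop-∙ (loop-shift (g ∘ suc) (f ∘ suc))
            (⇒case-∙ ⇒var (⇒∙ (⇒∙ (⇒∙ ⇒nil ⇒var) ⇒var) ⇒var))

      go : ∀ m′ (f′ : Fin m′ → Tree) → m′ ≤ Q → Loop (encodeList (tabulate f) ∷ []) nilᵗ _
             (encodeList (tabulate f′)) (encodeList (tabulate λ i → encodeℕ (toℕ i) ∙ f′ i))
      go zero     f′ le = loop-nil ⇒nil
      go (suc m′) f′ le = loop-∙ (go m′ (f′ ∘ suc) (≤-trans (n≤1+n _) le))
        (⇒∙ (⇒∙ ⇒nil ⇒var) (call₁ (shift-⇒ toℕ (f′ ∘ suc) (≤-trans (n≤1+n _) le))))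

  vertices-⇒ : encodeGraph G ∷ [] ⊨ verticesᵗ ⇒ vertices (allFin n)
  vertices-⇒ = ⇒-≡ (cong encodeList (sym (map-tabulate (λ i → i) vertex))) (encodeList-tabulate-⇒ n row n≤Q)

  module _ (k : ℕ) (leK : 5 + k ≤ Q)
           (few : ∀ X v C → missing C ≤ 5 + k → length C ≤ n → length (indepSets (filterᵇ (allowed X) (v ∷ C))) ≤ Q) where

    main-⇒ : (encodeGraph G ∙ encodeℕ k) ∷ [] ⊨ mainᵗ ⇒ encodeBool (decide k)
    main-⇒ = ⇒case-∙ ⇒var (⇒call (⇒var ∷ call₁ vertices-⇒ ∷ []) decide-⇒)
      where
        V = allFin n
        len : length V ≤ n
        len = ≤-reflexive (length-tabulate {n = n} (λ i → i))
        decide-⇒ : encodeℕ k ∷ vertices V ∷ [] ⊨ decideᵗ ⇒ encodeBool (decide k)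
        decide-⇒ with solve k [] V | solve-⇒ k (≤-trans (m≤n+m k 5) leK)
                        (λ X v C miss → few X v C (≤-trans miss (m≤n+m k 5))) [] V z≤n len
        ... | just _  | p = ⇒case-∙ (⇒call (⇒var ∷ ⇒nil ∷ ⇒var ∷ []) p) (⇒∙ ⇒nil ⇒nil)
        ... | nothing | p = ⇒case-nil (⇒call (⇒var ∷ ⇒nil ∷ ⇒var ∷ []) p)
          (⇒call (⇒∙ ⇒nil (⇒∙ ⇒nil (⇒∙ ⇒nil (⇒∙ ⇒nil (⇒∙ ⇒nil ⇒var)))) ∷ ⇒var ∷ ⇒nil ∷ [])
            (guess-⇒ (5 + k) leK few 5 V [] (≤-trans (m≤m+n 5 k) leK) len))

-- The structure of pseudosplit graphs

C₅ : Graph 5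
C₅ .adj    = joins ((0 , 1) ∷ (1 , 2) ∷ (2 , 3) ∷ (3 , 4) ∷ (4 , 0) ∷ [])
C₅ .Graph.sym = from-yes (Fin.all? λ i → Fin.all? λ j → adj C₅ i j ≟ᵇ adj C₅ j i)
C₅ .irrefl = from-yes (Fin.all? λ i → adj C₅ i i ≟ᵇ false)

module Structure {n} (G : Graph n) where

  infix 4 _~_ _≁_

  _~_ _≁_ : Fin n → Fin n → Set
  a ~ b = adj G a b ≡ true
  a ≁ b = adj G a b ≡ false

  ~-sym : ∀ {a b} → a ~ b → b ~ a
  ~-sym {a} {b} e = trans (Graph.sym G b a) e

  ≁-sym : ∀ {a b} → a ≁ b → b ≁ a
  ≁-sym {a} {b} e = trans (Graph.sym G b a) e

  ~⇒≢ : ∀ {a b} → a ~ b → a ≢ b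
  ~⇒≢ {a} e refl = not-¬ (irrefl G a) e

  separated : ∀ {a b x} → a ~ x → b ≁ x → a ≢ b
  separated p q refl = not-¬ q p

  induced : ∀ (H : Graph 4) {a b c d} →
    a ≢ b → a ≢ c → a ≢ d → b ≢ c → b ≢ d → c ≢ d →
    adj G a b ≡ adj H 0F 1F → adj G a c ≡ adj H 0F 2F → adj G a d ≡ adj H 0F 3F →
    adj G b c ≡ adj H 1F 2F → adj G b d ≡ adj H 1F 3F → adj G c d ≡ adj H 2F 3F →
    H isInducedSubgraphOf G
  induced H {a} {b} {c} {d} ab ac ad bc bd cd ab′ ac′ ad′ bc′ bd′ cd′ = φ , inj , pres
    where
      φ : Fin 4 → Fin n
      φ = Vec.lookup (a ∷ b ∷ c ∷ d ∷ [])

      inj : ∀ {i j} → φ i ≡ φ j → i ≡ j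
      inj {0F} {0F} e = refl
      inj {0F} {1F} e = ⊥-elim (ab e)
      inj {0F} {2F} e = ⊥-elim (ac e)
      inj {0F} {3F} e = ⊥-elim (ad e)
      inj {1F} {0F} e = ⊥-elim (ab (sym e))
      inj {1F} {1F} e = refl
      inj {1F} {2F} e = ⊥-elim (bc e)
      inj {1F} {3F} e = ⊥-elim (bd e)
      inj {2F} {0F} e = ⊥-elim (ac (sym e))
      inj {2F} {1F} e = ⊥-elim (bc (sym e))
      inj {2F} {2F} e = refl
      inj {2F} {3F} e = ⊥-elim (cd e)
      inj {3F} {0F} e = ⊥-elim (ad (sym e))
      inj {3F} {1F} e = ⊥-elim (bd (sym e))
      inj {3F} {2F} e = ⊥-elim (cd (sym e))
      inj {3F} {3F} e = refl

      flip : ∀ {u w} i j → adj G u w ≡ adj H i j → adj G w u ≡ adj H j i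
      flip i j e = trans (Graph.sym G _ _) (trans e (Graph.sym H i j))

      same : ∀ u i → adj G u u ≡ adj H i i
      same u i = trans (irrefl G u) (sym (irrefl H i))

      pres : ∀ i j → adj G (φ i) (φ j) ≡ adj H i j
      pres 0F 0F = same a 0F
      pres 0F 1F = ab′
      pres 0F 2F = ac′
      pres 0F 3F = ad′
      pres 1F 0F = flip 0F 1F ab′
      pres 1F 1F = same b 1F
      pres 1F 2F = bc′
      pres 1F 3F = bd′
      pres 2F 0F = flip 0F 2F ac′
      pres 2F 1F = flip 1F 2F bc′
      pres 2F 2F = same c 2F
      pres 2F 3F = cd′
      pres 3F 0F = flip 0F 3F ad′
      pres 3F 1F = flip 1F 3F bd′
      pres 3F 2F = flip 2F 3F cd′
      pres 3F 3F = same d 3F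

  record Pentagon : Set where
    field
      corner      : Fin 5 → Fin n
      corner-adj  : ∀ i j → adj G (corner i) (corner j) ≡ adj C₅ i j

    private
      twin-free : ∀ i j → (∀ k → adj C₅ i k ≡ adj C₅ j k) → i ≡ j
      twin-free = from-yes (Fin.all? λ i → Fin.all? λ j →
        Fin.all? (λ k → adj C₅ i k ≟ᵇ adj C₅ j k) →-dec (i Fin.≟ j))

    -- No two vertices of the 5-cycle have the same neighbours, so the adjacency pattern alone
    -- forces the corners to be distinct.
    corner-injective : ∀ {i j} → corner i ≡ corner j → i ≡ j
    corner-injective {i} {j} e = twin-free i j λ k →
      trans (sym (corner-adj i k)) (trans (cong (λ u → adj G u (corner k)) e) (corner-adj j k))

  pentagon : ∀ {a b c d e} → a ~ b → b ~ c → c ~ d → d ~ e → e ~ a →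
             a ≁ c → b ≁ d → c ≁ e → d ≁ a → e ≁ b → Pentagon
  pentagon {a} {b} {c} {d} {e} ab bc cd de ea ac bd ce da eb =
    record { corner = Vec.lookup (a ∷ b ∷ c ∷ d ∷ e ∷ []) ; corner-adj = pres }
    where
      pres : ∀ i j → adj G (Vec.lookup (a ∷ b ∷ c ∷ d ∷ e ∷ []) i) (Vec.lookup (a ∷ b ∷ c ∷ d ∷ e ∷ []) j) ≡ adj C₅ i j
      pres 0F 0F = irrefl G a
      pres 0F 1F = ab
      pres 0F 2F = ac
      pres 0F 3F = ≁-sym da
      pres 0F 4F = ~-sym ea
      pres 1F 0F = ~-sym ab
      pres 1F 1F = irrefl G b
      pres 1F 2F = bc
      pres 1F 3F = bd
      pres 1F 4F = ≁-sym eb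
      pres 2F 0F = ≁-sym ac
      pres 2F 1F = ~-sym bc
      pres 2F 2F = irrefl G c
      pres 2F 3F = cd
      pres 2F 4F = ce
      pres 3F 0F = da
      pres 3F 1F = ≁-sym bd
      pres 3F 2F = ~-sym cd
      pres 3F 3F = irrefl G d
      pres 3F 4F = de
      pres 4F 0F = ea
      pres 4F 1F = eb
      pres 4F 2F = ≁-sym ce
      pres 4F 3F = ~-sym de
      pres 4F 4F = irrefl G e

  -- The label true stands for the clique side.
  Split : (Fin n → Set) → (Fin n → Bool) → Set
  Split P s = ∀ {u w} → P u → P w → u ≢ w → s u ≡ s w → adj G u w ≡ s u

  _[_↦_] : (Fin n → Bool) → Fin n → Bool → Fin n → Bool
  (s [ x ↦ b ]) u with u Fin.≟ x
  ... | yes _ = b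
  ... | no  _ = s u

  relabelled⁻ : ∀ s x b {u b′} → (s [ x ↦ b ]) u ≡ b′ → (u ≡ x × b ≡ b′) ⊎ (u ≢ x × s u ≡ b′)
  relabelled⁻ s x b {u} e with u Fin.≟ x
  ... | yes p = inj₁ (p , e)
  ... | no ¬p = inj₂ (¬p , e)

  relabel : ∀ {P s} x b → Split (λ u → P u × u ≢ x) s →
            (∀ {u} → P u → u ≢ x → s u ≡ b → adj G x u ≡ b) → Split P (s [ x ↦ b ])
  relabel x b old new {u} {w} Pu Pw u≢w e with u Fin.≟ x | w Fin.≟ x
  ... | yes refl | yes refl = ⊥-elim (u≢w refl)
  ... | yes refl | no w≢x   = new Pw w≢x (sym e)
  ... | no u≢x   | yes refl = trans (Graph.sym G u x) (trans (new Pu u≢x e) (sym e))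
  ... | no u≢x   | no w≢x   = old (Pu , u≢x) (Pw , w≢x) u≢w e

  module _ (pseudosplit : Pseudosplit G) where

    no-C₄ : ∀ {a b c d} → a ~ b → b ~ c → c ~ d → d ~ a → a ≁ c → b ≁ d → a ≢ c → b ≢ d → ⊥
    no-C₄ ab bc cd da ac bd a≢c b≢d = proj₂ pseudosplit
      (induced C₄ (~⇒≢ ab) a≢c (≢-sym (~⇒≢ da)) (~⇒≢ bc) b≢d (~⇒≢ cd) ab ac (~-sym da) bc bd cd)

    no-2K₂ : ∀ {a b c d} → a ~ b → c ~ d → a ≁ c → a ≁ d → b ≁ c → b ≁ d → ⊥
    no-2K₂ ab cd ac ad bc bd = proj₁ pseudosplit
      (induced 2K₂ (~⇒≢ ab) (separated ab (≁-sym bc)) (separated ab (≁-sym bd))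
        (separated (~-sym ab) (≁-sym ac)) (separated (~-sym ab) (≁-sym ad)) (~⇒≢ cd) ab ac ad bc bd cd)

    search : ∀ {P : Fin n → Set} → Decidable P → ∀ W → (∃[ u ] u ∈ W × P u) ⊎ (∀ {u} → u ∈ W → ¬ P u)
    search P? W with any? P? W
    ... | yes p = inj₁ (find p)
    ... | no ¬p = inj₂ λ u∈ Pu → ¬p (lose u∈ Pu)

    _~?_ : ∀ a b → Dec (a ~ b)
    a ~? b = adj G a b ≟ᵇ true

    -- Write C₁, C₂ for the clique vertices adjacent and non-adjacent to `v`, and I₁, I₂ likewise on
    -- the independent side. Only C₂ and I₁ obstruct `v`. If one of them is empty, `v` joins a side
    -- at once; if one is a single vertex, moving at most two vertices makes room; if both have two
    -- vertices, there is a pentagon.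
    module Insert {W s} (split : Split (_∈ W) s) {v} (v∉W : ¬ v ∈ W) where

      Result : Set
      Result = (∃[ s ] Split (_∈ v ∷ W) s) ⊎ Pentagon

      record C₂ (u : Fin n) : Set where
        constructor c₂
        field
          in-W : u ∈ W
          side : s u ≡ true
          to-v : v ≁ u

      record I₁ (u : Fin n) : Set where
        constructor i₁
        field
          in-W : u ∈ W
          side : s u ≡ false
          to-v : v ~ u

      v≢ : ∀ {u} → u ∈ W → v ≢ u
      v≢ u∈W refl = v∉W u∈W

      clique : ∀ {u w} → u ∈ W → w ∈ W → u ≢ w → s u ≡ true → s w ≡ true → u ~ w
      clique u∈ w∈ ne su sw = trans (split u∈ w∈ ne (trans su (sym sw))) su

      indep : ∀ {u w} → u ∈ W → w ∈ W → u ≢ w → s u ≡ false → s w ≡ false → u ≁ w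
      indep u∈ w∈ ne su sw = trans (split u∈ w∈ ne (trans su (sym sw))) su

      sides≢ : ∀ {u w} → s u ≡ true → s w ≡ false → u ≢ w
      sides≢ su sw refl = not-¬ sw su

      one-neighbour : ∀ {i j c} → I₁ i → I₁ j → i ≢ j → C₂ c → i ~ c → j ≁ c
      one-neighbour (i₁ i∈ si vi) (i₁ j∈ sj vj) ne (c₂ c∈ sc vc) ic = ¬-not λ jc →
        no-C₄ vi ic (~-sym jc) (~-sym vj) vc (indep i∈ j∈ ne si sj) (v≢ c∈) ne

      one-non-neighbour : ∀ {i c d} → I₁ i → C₂ c → C₂ d → c ≢ d → i ≁ c → i ~ d
      one-non-neighbour (i₁ i∈ si vi) (c₂ c∈ sc vc) (c₂ d∈ sd vd) ne ic = ¬-not λ id →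
        no-2K₂ vi (clique c∈ d∈ ne sc sd) vc vd ic id

      C₁-complete : ∀ {i c u} → I₁ i → C₂ c → i ~ c → u ∈ W → s u ≡ true → v ~ u → i ~ u
      C₁-complete (i₁ i∈ si vi) (c₂ c∈ sc vc) ic u∈ su vu = ¬-not λ iu →
        no-C₄ vi ic (clique c∈ u∈ (≢-sym (separated (~-sym vu) (≁-sym vc))) sc su) (~-sym vu)
              vc iu (v≢ c∈) (≢-sym (sides≢ su si))

      I₂-anticomplete : ∀ {i c j} → I₁ i → C₂ c → i ≁ c → j ∈ W → s j ≡ false → v ≁ j → c ≁ j
      I₂-anticomplete (i₁ i∈ si vi) (c₂ c∈ sc vc) ic j∈ sj vj = ¬-not λ cj →
        no-2K₂ vi (~-sym cj) vj vc (indep i∈ j∈ (separated (~-sym vi) (≁-sym vj)) si sj) ic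

      add : ∀ {s′} b → Split (_∈ W) s′ → (∀ {u} → u ∈ W → s′ u ≡ b → adj G v u ≡ b) → Result
      add {s′} b sp h = inj₁ (s′ [ v ↦ b ] , relabel v b
        (λ Pu Pw → sp (drop-v Pu) (drop-v Pw)) λ u∈ u≢v → h (drop-v (u∈ , u≢v)))
        where
          drop-v : ∀ {u} → u ∈ v ∷ W × u ≢ v → u ∈ W
          drop-v (here refl , u≢v) = ⊥-elim (u≢v refl)
          drop-v (there u∈ , _)    = u∈

      move : ∀ x b → (∀ {u} → u ∈ W → u ≢ x → s u ≡ b → adj G x u ≡ b) → Split (_∈ W) (s [ x ↦ b ])
      move x b = relabel x b λ Pu Pw → split (proj₁ Pu) (proj₁ Pw)

      -- Nothing is asked of the pair `c`, `i`, which stays on opposite sides. This is why `c` is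
      -- relabelled while `i` is still excluded.
      swap : ∀ c i → (∀ {u} → u ∈ W → u ≢ i → u ≢ c → s u ≡ false → c ≁ u) →
             (∀ {u} → u ∈ W → u ≢ i → u ≢ c → s u ≡ true → i ~ u) →
             Split (_∈ W) (s [ c ↦ false ] [ i ↦ true ])
      swap c i hc hi = relabel i true
        (relabel c false (λ Pu Pw → split (proj₁ (proj₁ Pu)) (proj₁ (proj₁ Pw)))
          λ (u∈ , u≢i) u≢c → hc u∈ u≢i u≢c)
        λ u∈ u≢i e → case-i u∈ u≢i (relabelled⁻ s c false e)
        where
          case-i : ∀ {u} → u ∈ W → u ≢ i → (u ≡ c × false ≡ true) ⊎ (u ≢ c × s u ≡ true) → i ~ u
          case-i u∈ u≢i (inj₂ (u≢c , su)) = hi u∈ u≢i u≢c su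

      -- Only i prevents v from joining the independent side, and i can join the clique.
      exchange-i : ∀ {i} → (∀ {u} → I₁ u → u ≡ i) → (∀ {u} → u ∈ W → s u ≡ true → i ~ u) → Result
      exchange-i {i} only complete = add false (move i true λ u∈ _ → complete u∈) λ u∈ e → to-v u∈ (relabelled⁻ s i true e)
        where
          to-v : ∀ {u} → u ∈ W → (u ≡ i × true ≡ false) ⊎ (u ≢ i × s u ≡ false) → v ≁ u
          to-v u∈ (inj₂ (u≢i , su)) = ¬-not λ vu → u≢i (only (i₁ u∈ su vu))

      exchange-c : ∀ {c} → (∀ {u} → C₂ u → u ≡ c) → (∀ {u} → u ∈ W → s u ≡ false → c ≁ u) → Result
      exchange-c {c} only anti = add true (move c false λ u∈ _ → anti u∈) λ u∈ e → to-v u∈ (relabelled⁻ s c false e)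
        where
          to-v : ∀ {u} → u ∈ W → (u ≡ c × false ≡ true) ⊎ (u ≢ c × s u ≡ true) → v ~ u
          to-v u∈ (inj₂ (u≢c , su)) = ¬-not λ vu → u≢c (only (c₂ u∈ su vu))

      v~⊎≁ : ∀ u → v ~ u ⊎ v ≁ u
      v~⊎≁ u with adj G v u
      ... | true  = inj₁ refl
      ... | false = inj₂ refl

      C₂? : Decidable (λ u → s u ≡ true × v ≁ u)
      C₂? u = (s u ≟ᵇ true) ×-dec (adj G v u ≟ᵇ false)

      I₁? : Decidable (λ u → s u ≡ false × v ~ u)
      I₁? u = (s u ≟ᵇ false) ×-dec (adj G v u ≟ᵇ true)

      -- If `c` has no neighbour in I₁, it is anticomplete to the independent side and trades places
      -- with `v`. Otherwise let `j` be such a neighbour. If `j` is all of I₁, it moves to the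
      -- clique and `v` becomes independent. If there is another `j′`, then `j′` is not adjacent to
      -- `c`, which makes `c` anticomplete to I₂; `c` and `j` swap and `v` joins the clique.
      one-C₂ : ∀ {c i} → C₂ c → I₁ i → (∀ {u} → C₂ u → u ≡ c) → Result
      one-C₂ {c} {i} C I onlyC with search (λ u → I₁? u ×-dec (u ~? c)) W
      ... | inj₂ none = exchange-c onlyC anti
        where
          i≁c = ¬-not (λ ic → none (I₁.in-W I) ((I₁.side I , I₁.to-v I) , ic))
          anti : ∀ {u} → u ∈ W → s u ≡ false → c ≁ u
          anti {u} u∈ su with v~⊎≁ u
          ... | inj₁ vu = ≁-sym (¬-not λ uc → none u∈ ((su , vu) , uc))
          ... | inj₂ vu = I₂-anticomplete I C i≁c u∈ su vu
      ... | inj₁ (j , j∈ , (sj , vj) , jc) with search (λ u → I₁? u ×-dec ¬? (u Fin.≟ j)) W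
      ...   | inj₂ none = exchange-i onlyI complete
        where
          onlyI : ∀ {u} → I₁ u → u ≡ j
          onlyI {u} (i₁ u∈ su vu) with u Fin.≟ j
          ... | yes e = e
          ... | no ne = ⊥-elim (none u∈ ((su , vu) , ne))
          complete : ∀ {u} → u ∈ W → s u ≡ true → j ~ u
          complete {u} u∈ su with v~⊎≁ u
          ... | inj₁ vu = C₁-complete (i₁ j∈ sj vj) C jc u∈ su vu
          ... | inj₂ vu with refl ← onlyC (c₂ u∈ su vu) = jc
      ...   | inj₁ (j′ , j′∈ , (sj′ , vj′) , j′≢j) = add true (swap c j anti complete) to-v
        where
          J  = i₁ j∈ sj vj
          J′ = i₁ j′∈ sj′ vj′
          anti : ∀ {u} → u ∈ W → u ≢ j → u ≢ c → s u ≡ false → c ≁ u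
          anti {u} u∈ u≢j _ su with v~⊎≁ u
          ... | inj₁ vu = ≁-sym (one-neighbour J (i₁ u∈ su vu) (≢-sym u≢j) C jc)
          ... | inj₂ vu = I₂-anticomplete J′ C (one-neighbour J J′ (≢-sym j′≢j) C jc) u∈ su vu
          v~C₁ : ∀ {u} → u ∈ W → u ≢ c → s u ≡ true → v ~ u
          v~C₁ u∈ u≢c su = ¬-not λ vu → u≢c (onlyC (c₂ u∈ su vu))
          complete : ∀ {u} → u ∈ W → u ≢ j → u ≢ c → s u ≡ true → j ~ u
          complete u∈ _ u≢c su = C₁-complete J C jc u∈ su (v~C₁ u∈ u≢c su)
          to-v : ∀ {u} → u ∈ W → (s [ c ↦ false ] [ j ↦ true ]) u ≡ true → v ~ u
          to-v {u} u∈ e with relabelled⁻ (s [ c ↦ false ]) j true {u} e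
          ... | inj₁ (refl , _) = vj
          ... | inj₂ (_ , e′) with relabelled⁻ s c false {u} e′
          ...   | inj₂ (u≢c , su) = v~C₁ u∈ u≢c su

      -- In every case `v` becomes independent. Either `i` is complete to C₂ and moves to the
      -- clique, or it misses exactly one `e` there and the two swap.
      one-I₁ : ∀ {c d i} → C₂ c → C₂ d → c ≢ d → I₁ i → (∀ {u} → I₁ u → u ≡ i) → Result
      one-I₁ {c} {d} {i} C D c≢d I onlyI with search (λ u → C₂? u ×-dec (adj G i u ≟ᵇ false)) W
      ... | inj₂ none = exchange-i onlyI complete
        where
          complete : ∀ {u} → u ∈ W → s u ≡ true → i ~ u
          complete {u} u∈ su with v~⊎≁ u
          ... | inj₁ vu = C₁-complete I C (¬-not λ ic → none (C₂.in-W C) ((C₂.side C , C₂.to-v C) , ic)) u∈ su vu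
          ... | inj₂ vu = ¬-not λ iu → none u∈ ((su , vu) , iu)
      ... | inj₁ (e , e∈ , (se , ve) , ie) = add false (swap e i anti complete) to-v
        where
          E = c₂ e∈ se ve
          -- `C₁-complete` needs a vertex of C₂ adjacent to `i`; as `i` misses only `e`, one of `c`
          -- and `d` serves.
          neighbour : ∃[ w ] C₂ w × i ~ w
          neighbour with e Fin.≟ c
          ... | yes refl = d , D , one-non-neighbour I E D c≢d ie
          ... | no e≢c   = c , C , one-non-neighbour I E C e≢c ie
          anti : ∀ {u} → u ∈ W → u ≢ i → u ≢ e → s u ≡ false → e ≁ u
          anti u∈ u≢i _ su = I₂-anticomplete I E ie u∈ su (¬-not λ vu → u≢i (onlyI (i₁ u∈ su vu)))
          complete : ∀ {u} → u ∈ W → u ≢ i → u ≢ e → s u ≡ true → i ~ u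
          complete {u} u∈ _ u≢e su with v~⊎≁ u
          ... | inj₁ vu = let _ , C′ , ic′ = neighbour in C₁-complete I C′ ic′ u∈ su vu
          ... | inj₂ vu = one-non-neighbour I E (c₂ u∈ su vu) (≢-sym u≢e) ie
          to-v : ∀ {u} → u ∈ W → (s [ e ↦ false ] [ i ↦ true ]) u ≡ false → v ≁ u
          to-v {u} u∈ eq with relabelled⁻ (s [ e ↦ false ]) i true {u} eq
          ... | inj₂ (u≢i , eq′) with relabelled⁻ s e false {u} eq′
          ...   | inj₁ (refl , _)  = ve
          ...   | inj₂ (_ , su)    = ¬-not λ vu → u≢i (onlyI (i₁ u∈ su vu))

      -- `one-neighbour` and `one-non-neighbour` force the edges between the two pairs to be a
      -- perfect matching. Going from `v` through one matching edge, along the edge `c d` and back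
      -- through the other closes the pentagon.
      two-two : ∀ {c d i j} → C₂ c → C₂ d → c ≢ d → I₁ i → I₁ j → i ≢ j → Pentagon
      two-two {c} {d} {i} {j} C D c≢d I J i≢j with adj G i c in ic
      ... | true  = pentagon (I₁.to-v I) ic (clique (C₂.in-W C) (C₂.in-W D) c≢d (C₂.side C) (C₂.side D))
                      (~-sym jd) (~-sym (I₁.to-v J)) (C₂.to-v C) id (≁-sym jc) (≁-sym (C₂.to-v D))
                      (indep (I₁.in-W J) (I₁.in-W I) (≢-sym i≢j) (I₁.side J) (I₁.side I))
        where
          jc = one-neighbour I J i≢j C ic
          jd = one-non-neighbour J C D c≢d jc
          id = one-neighbour J I (≢-sym i≢j) D jd
      ... | false = pentagon (I₁.to-v I) id (clique (C₂.in-W D) (C₂.in-W C) (≢-sym c≢d) (C₂.side D) (C₂.side C))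
                      (~-sym jc) (~-sym (I₁.to-v J)) (C₂.to-v D) ic (≁-sym jd) (≁-sym (C₂.to-v C))
                      (indep (I₁.in-W J) (I₁.in-W I) (≢-sym i≢j) (I₁.side J) (I₁.side I))
        where
          id = one-non-neighbour I C D c≢d ic
          jd = one-neighbour I J i≢j D id
          jc = one-non-neighbour J D C (≢-sym c≢d) jd

      insert : Result
      insert with search C₂? W | search I₁? W
      ... | inj₂ none | _ = add true split λ u∈ su → ¬-not λ vu → none u∈ (su , vu)
      ... | inj₁ _ | inj₂ none = add false split λ u∈ su → ¬-not λ vu → none u∈ (su , vu)
      ... | inj₁ (c , c∈ , sc , vc) | inj₁ (i , i∈ , si , vi)
        with search (λ u → C₂? u ×-dec ¬? (u Fin.≟ c)) W | search (λ u → I₁? u ×-dec ¬? (u Fin.≟ i)) W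
      ...   | inj₂ none | _ = one-C₂ (c₂ c∈ sc vc) (i₁ i∈ si vi) only
        where
          only : ∀ {u} → C₂ u → u ≡ c
          only {u} (c₂ u∈ su vu) with u Fin.≟ c
          ... | yes e = e
          ... | no ne = ⊥-elim (none u∈ ((su , vu) , ne))
      ...   | inj₁ (d , d∈ , (sd , vd) , d≢c) | inj₂ none =
        one-I₁ (c₂ c∈ sc vc) (c₂ d∈ sd vd) (≢-sym d≢c) (i₁ i∈ si vi) only
        where
          only : ∀ {u} → I₁ u → u ≡ i
          only {u} (i₁ u∈ su vu) with u Fin.≟ i
          ... | yes e = e
          ... | no ne = ⊥-elim (none u∈ ((su , vu) , ne))
      ...   | inj₁ (d , d∈ , (sd , vd) , d≢c) | inj₁ (j , j∈ , (sj , vj) , j≢i) =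
        inj₂ (two-two (c₂ c∈ sc vc) (c₂ d∈ sd vd) (≢-sym d≢c) (i₁ i∈ si vi) (i₁ j∈ sj vj) (≢-sym j≢i))

    split-or-pentagon : ∀ W → (∃[ s ] Split (_∈ W) s) ⊎ Pentagon
    split-or-pentagon [] = inj₁ ((λ _ → true) , λ ())
    split-or-pentagon (v ∷ W) with split-or-pentagon W
    ... | inj₂ p = inj₂ p
    ... | inj₁ (s , split) with any? (v Fin.≟_) W
    ...   | no v∉W  = Insert.insert split v∉W
    ...   | yes v∈W = inj₁ (s , λ u∈ w∈ → split (inW u∈) (inW w∈))
      where
        inW : ∀ {u} → u ∈ v ∷ W → u ∈ W
        inW (here refl) = v∈W
        inW (there u∈)  = u∈

    -- Suppose `u` misses `b`. Excluding the cycle `u a b c`, the edge pair `u a`, `c d` and the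
    -- cycle `u a e d` in turn gives u ≁ c, u ~ d and u ~ e; now `u e` and `b c` form a 2K₂.
    -- Rotating the lemma carries adjacency once around the pentagon.
    next-corner : ∀ {a b c d e u} → a ~ b → b ~ c → c ~ d → d ~ e → e ~ a →
                  a ≁ c → b ≁ d → c ≁ e → d ≁ a → e ≁ b → u ≢ b → u ≢ e → u ~ a → u ~ b
    next-corner {a} {b} {c} {d} {e} {u} ab bc cd de ea ac bd ce da eb u≢b u≢e ua = ¬-not λ ub →
      let u≁c = ¬-not λ uc → no-C₄ ua ab bc (~-sym uc) ub ac u≢b (separated (~-sym ea) ce)
          u~d = ¬-not λ ud → no-2K₂ ua cd u≁c ud ac (≁-sym da)
          u~e = ¬-not λ ue → no-C₄ ua (~-sym ea) (~-sym de) (~-sym u~d) ue (≁-sym da) u≢e (separated ab (≁-sym bd))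
      in no-2K₂ u~e bc ub u≁c eb (≁-sym ce)

    module AroundPentagon (p : Pentagon) where
      open Pentagon p

      Outside : Fin n → Set
      Outside u = ∀ i → u ≢ corner i

      private
        x = corner
        e = corner-adj

      from0 : ∀ {u} → Outside u → u ~ x 0F → u ~ x 1F
      from0 out = next-corner (e 0F 1F) (e 1F 2F) (e 2F 3F) (e 3F 4F) (e 4F 0F)
        (e 0F 2F) (e 1F 3F) (e 2F 4F) (e 3F 0F) (e 4F 1F) (out 1F) (out 4F)

      from1 : ∀ {u} → Outside u → u ~ x 1F → u ~ x 2F
      from1 out = next-corner (e 1F 2F) (e 2F 3F) (e 3F 4F) (e 4F 0F) (e 0F 1F)
        (e 1F 3F) (e 2F 4F) (e 3F 0F) (e 4F 1F) (e 0F 2F) (out 2F) (out 0F)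

      from2 : ∀ {u} → Outside u → u ~ x 2F → u ~ x 3F
      from2 out = next-corner (e 2F 3F) (e 3F 4F) (e 4F 0F) (e 0F 1F) (e 1F 2F)
        (e 2F 4F) (e 3F 0F) (e 4F 1F) (e 0F 2F) (e 1F 3F) (out 3F) (out 1F)

      from3 : ∀ {u} → Outside u → u ~ x 3F → u ~ x 4F
      from3 out = next-corner (e 3F 4F) (e 4F 0F) (e 0F 1F) (e 1F 2F) (e 2F 3F)
        (e 3F 0F) (e 4F 1F) (e 0F 2F) (e 1F 3F) (e 2F 4F) (out 4F) (out 2F)

      from4 : ∀ {u} → Outside u → u ~ x 4F → u ~ x 0F
      from4 out = next-corner (e 4F 0F) (e 0F 1F) (e 1F 2F) (e 2F 3F) (e 3F 4F)
        (e 4F 1F) (e 0F 2F) (e 1F 3F) (e 2F 4F) (e 3F 0F) (out 0F) (out 3F)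

      round : ∀ {u} → Outside u → u ~ x 0F → ∀ i → u ~ x i
      round out u0 0F = u0
      round out u0 1F = from0 out u0
      round out u0 2F = from1 out (from0 out u0)
      round out u0 3F = from2 out (from1 out (from0 out u0))
      round out u0 4F = from3 out (from2 out (from1 out (from0 out u0)))

      back : ∀ {u} → Outside u → ∀ i → u ~ x i → u ~ x 0F
      back out 0F ui = ui
      back out 1F ui = from4 out (from3 out (from2 out (from1 out ui)))
      back out 2F ui = from4 out (from3 out (from2 out ui))
      back out 3F ui = from4 out (from3 out ui)
      back out 4F ui = from4 out ui

      side : Fin n → Bool
      side u = adj G u (x 0F)

      corners-uniform : ∀ {u} → Outside u → ∀ i → adj G u (x i) ≡ side u
      corners-uniform {u} out i with adj G u (x 0F) in u0
      ... | true  = round out u0 i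
      ... | false = ¬-not λ ui → not-¬ u0 (back out i ui)

      -- Two non-adjacent complete vertices form a `C₄` with corners 0 and 2, and two adjacent
      -- anticomplete ones form a 2K₂ with the edge from corner 0 to corner 1.
      outside-split : Split Outside side
      outside-split {u} {w} outᵤ out_w u≢w same with adj G u (x 0F) in u0
      ... | true  = ¬-not λ uw → no-C₄ u0 (~-sym (sym same)) (round out_w (sym same) 2F)
                      (~-sym (round outᵤ u0 2F)) uw (e 0F 2F) u≢w (separated (e 0F 4F) (e 2F 4F))
      ... | false = ¬-not λ uw → no-2K₂ uw (e 0F 1F) u0 (anti outᵤ u0 1F) (sym same) (anti out_w (sym same) 1F)
        where
          anti : ∀ {u} → Outside u → u ≁ x 0F → ∀ i → u ≁ x i
          anti out u≁ i = trans (corners-uniform out i) u≁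

-- Correctness of the algorithm

pattern indepᴸ    = 0F
pattern cliqueᴸ   = 1F
pattern cornerᴸ i = suc (suc i)

-- clash b l m: distinct vertices labelled l and m cannot have adjacency b.
clash : Bool → Fin 7 → Fin 7 → Bool
clash b indepᴸ      cliqueᴸ     = false
clash b cliqueᴸ     indepᴸ      = false
clash b indepᴸ      indepᴸ      = b
clash b indepᴸ      (cornerᴸ _) = b
clash b (cornerᴸ _) indepᴸ      = b
clash b cliqueᴸ     cliqueᴸ     = not b
clash b cliqueᴸ     (cornerᴸ _) = not b
clash b (cornerᴸ _) cliqueᴸ     = not b
clash b (cornerᴸ i) (cornerᴸ j) = does (i Fin.≟ j) ∨ (b xor adj C₅ i j)

clashes : Graph 4 → Fin 7 → Fin 7 → Fin 7 → Fin 7 → Bool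
clashes H a b c d =
  clash (adj H 0F 1F) a b ∨ clash (adj H 0F 2F) a c ∨ clash (adj H 0F 3F) a d ∨
  clash (adj H 1F 2F) b c ∨ clash (adj H 1F 3F) b d ∨ clash (adj H 2F 3F) c d

-- An induced copy of a four-vertex graph would inherit one of 7⁴ labellings, so evaluation settles
-- the matter. Each corner has its own label; pairs between the clique and the independent side are
-- unconstrained and never clash.
2K₂-clashes : ∀ a b c d → clashes 2K₂ a b c d ≡ true
2K₂-clashes = from-yes (Fin.all? λ a → Fin.all? λ b → Fin.all? λ c → Fin.all? λ d → clashes 2K₂ a b c d ≟ᵇ true)

C₄-clashes : ∀ a b c d → clashes C₄ a b c d ≡ true
C₄-clashes = from-yes (Fin.all? λ a → Fin.all? λ b → Fin.all? λ c → Fin.all? λ d → clashes C₄ a b c d ≟ᵇ true)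

Conforms : ∀ {n} → Graph n → (Fin n → Fin 7) → Set
Conforms G lab = ∀ u w → u ≢ w → clash (adj G u w) (lab u) (lab w) ≡ false

conforms⇒pseudosplit : ∀ {n} {G : Graph n} {lab} → Conforms G lab → Pseudosplit G
conforms⇒pseudosplit {n} {G} {lab} conf = exclude 2K₂ 2K₂-clashes , exclude C₄ C₄-clashes
  where
    exclude : ∀ H → (∀ a b c d → clashes H a b c d ≡ true) → ¬ H isInducedSubgraphOf G
    exclude H bad (φ , inj , pres) = not-¬ none (bad (lab (φ 0F)) (lab (φ 1F)) (lab (φ 2F)) (lab (φ 3F)))
      where
        ok : ∀ i j → i ≢ j → clash (adj H i j) (lab (φ i)) (lab (φ j)) ≡ false
        ok i j i≢j = trans (cong (λ b → clash b (lab (φ i)) (lab (φ j))) (sym (pres i j)))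
                           (conf (φ i) (φ j) (i≢j ∘ inj))
        none : clashes H (lab (φ 0F)) (lab (φ 1F)) (lab (φ 2F)) (lab (φ 3F)) ≡ false
        none rewrite ok 0F 1F (λ ()) | ok 0F 2F (λ ()) | ok 0F 3F (λ ())
                   | ok 1F 2F (λ ()) | ok 1F 3F (λ ()) | ok 2F 3F (λ ()) = refl

-- Comparing edges with missing pairs

unique-⊆-length : ∀ {A : Set} {xs ys : List A} → Unique xs → xs ⊆ ys → length xs ≤ length ys
unique-⊆-length [] _ = z≤n
unique-⊆-length {xs = x ∷ xs} (x∉xs ∷ uniq) sub with as , bs , refl ← ∈-∃++ (sub (here refl)) = begin
  suc (length xs)               ≤⟨ s≤s (unique-⊆-length uniq sub′) ⟩
  suc (length (as ++ bs))       ≡⟨ cong suc (length-++ as) ⟩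
  suc (length as + length bs)   ≡⟨ sym (+-suc (length as) (length bs)) ⟩
  length as + suc (length bs)   ≡⟨ sym (length-++ as) ⟩
  length (as ++ x ∷ bs)         ∎
  where
    open ≤-Reasoning
    sub′ : xs ⊆ as ++ bs
    sub′ y∈ with ∈-++⁻ as (sub (there y∈))
    ... | inj₁ y∈as         = ∈-++⁺ˡ y∈as
    ... | inj₂ (here refl)  = ⊥-elim (All.lookup x∉xs y∈ refl)
    ... | inj₂ (there y∈bs) = ∈-++⁺ʳ as y∈bs

<ᵇ-true : ∀ {m n} → m < n → (m <ᵇ n) ≡ true
<ᵇ-true m<n = Equivalence.to T-≡ (<⇒<ᵇ m<n)

<ᵇ-true⁻ : ∀ {m n} → (m <ᵇ n) ≡ true → m < n
<ᵇ-true⁻ {m} {n} e = <ᵇ⇒< m n (Equivalence.from T-≡ e)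

module _ {n} (S : Graph n) where

  ∈-edges⁺ : ∀ {i j} → toℕ i < toℕ j → adj S i j ≡ true → (i , j) ∈ edges S
  ∈-edges⁺ {i} {j} i<j e = ∈-filterᵇ⁺ (∈-cartesianProduct⁺ (∈-allFin i) (∈-allFin j)) (cong₂ _∧_ (<ᵇ-true i<j) e)

  ∈-edges⁻ : ∀ {i j} → (i , j) ∈ edges S → toℕ i < toℕ j × adj S i j ≡ true
  ∈-edges⁻ {i} {j} p with l , e ← ∧-true⁻ {toℕ i <ᵇ toℕ j} (proj₂ (∈-filterᵇ⁻ {p = λ (i , j) → (toℕ i <ᵇ toℕ j) ∧ adj S i j} {xs = cartesianProduct (allFin n) (allFin n)} p)) = <ᵇ-true⁻ l , e

  edges-unique : Unique (edges S)
  edges-unique = Unique.filter⁺ (T? ∘ _) (Unique.cartesianProduct⁺ (Unique.allFin⁺ n) (Unique.allFin⁺ n))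

module Pairs {n} (G : Graph n) where

  open Algorithm G

  missingPairs : List (Fin n) → List (Fin n × Fin n)
  missingPairs []       = []
  missingPairs (x ∷ xs) = map (x ,_) (nonNbrs x xs) ++ missingPairs xs

  length-missingPairs : ∀ L → length (missingPairs L) ≡ missing L
  length-missingPairs []       = refl
  length-missingPairs (x ∷ xs) = trans (length-++ (map (x ,_) (nonNbrs x xs)))
    (cong₂ _+_ (length-map (x ,_) (nonNbrs x xs)) (length-missingPairs xs))

  -- `edges` lists every pair with the smaller vertex in front. Sublists of `allFin n` are sorted,
  -- so their missing pairs have the same orientation and the two lists can be compared by
  -- inclusion.
  Sorted : List (Fin n) → Set
  Sorted = AllPairs (λ i j → toℕ i < toℕ j)

  record MissingPair (L : List (Fin n)) (i j : Fin n) : Set where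
    constructor missingPair
    field
      ordered  : toℕ i < toℕ j
      left     : i ∈ L
      right    : j ∈ L
      non-edge : adj G i j ≡ false

  ∈-missingPairs⁻ : ∀ {L i j} → Sorted L → (i , j) ∈ missingPairs L → MissingPair L i j
  ∈-missingPairs⁻ {x ∷ xs} (x< ∷ sorted) p with ∈-++⁻ (map (x ,_) (nonNbrs x xs)) p
  ... | inj₁ q with y , y∈ , refl ← ∈-map⁻ (x ,_) q
               with y∈xs , e ← ∈-filterᵇ⁻ {p = λ y → not (adj G x y)} {xs = xs} y∈
    = missingPair (All.lookup x< y∈xs) (here refl) (there y∈xs) (not-true⁻ e)
  ... | inj₂ q with missingPair o l r e ← ∈-missingPairs⁻ sorted q = missingPair o (there l) (there r) e

  ∈-missingPairs⁺ : ∀ {L i j} → Sorted L → MissingPair L i j → (i , j) ∈ missingPairs L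
  ∈-missingPairs⁺ _ (missingPair o (here refl) (here refl) e) = ⊥-elim (<-irrefl refl o)
  ∈-missingPairs⁺ {x ∷ xs} _ (missingPair o (here refl) (there r) e) =
    ∈-++⁺ˡ (∈-map⁺ (x ,_) (∈-filterᵇ⁺ {p = λ y → not (adj G x y)} r (cong not e)))
  ∈-missingPairs⁺ (x< ∷ _) (missingPair o (there l) (here refl) e) = ⊥-elim (<-asym o (All.lookup x< l))
  ∈-missingPairs⁺ {x ∷ xs} (_ ∷ sorted) (missingPair o (there l) (there r) e) =
    ∈-++⁺ʳ (map (x ,_) (nonNbrs x xs)) (∈-missingPairs⁺ sorted (missingPair o l r e))

  missingPairs-unique : ∀ {L} → Sorted L → Unique (missingPairs L)
  missingPairs-unique [] = []
  missingPairs-unique {x ∷ xs} (x< ∷ sorted) = Unique.++⁺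
    (Unique.map⁺ (λ { refl → refl }) (Unique.filter⁺ (T? ∘ _) (AllPairs.map (λ { l refl → <-irrefl refl l }) sorted)))
    (missingPairs-unique sorted)
    λ { (p , q) → disjoint p q }
    where
      disjoint : ∀ {p} → p ∈ map (x ,_) (nonNbrs x xs) → p ∈ missingPairs xs → ⊥
      disjoint p q with y , _ , refl ← ∈-map⁻ (x ,_) p =
        <-irrefl refl (All.lookup x< (MissingPair.left (∈-missingPairs⁻ sorted q)))

  V : List (Fin n)
  V = allFin n

  module _ (q : Fin n → Bool) where

    private
      sorted : Sorted (filterᵇ q V)
      sorted = AllPairs.filter⁺ (T? ∘ q) (AllPairs.tabulate⁺-< (λ i<j → i<j))

    cliquePairs : List (Fin n × Fin n)
    cliquePairs = missingPairs (filterᵇ q V)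

    ∈-cliquePairs⁺ : ∀ {i j} → toℕ i < toℕ j → q i ≡ true → q j ≡ true → adj G i j ≡ false → (i , j) ∈ cliquePairs
    ∈-cliquePairs⁺ {i} {j} o qi qj e = ∈-missingPairs⁺ sorted
      (missingPair o (∈-filterᵇ⁺ (∈-allFin i) qi) (∈-filterᵇ⁺ (∈-allFin j) qj) e)

    ∈-cliquePairs⁻ : ∀ {i j} → (i , j) ∈ cliquePairs → toℕ i < toℕ j × q i ≡ true × q j ≡ true × adj G i j ≡ false
    ∈-cliquePairs⁻ p with missingPair o l r e ← ∈-missingPairs⁻ sorted p =
      o , proj₂ (∈-filterᵇ⁻ {p = q} {xs = V} l) , proj₂ (∈-filterᵇ⁻ {p = q} {xs = V} r) , e

    missing-≤ : ∀ {ps} → cliquePairs ⊆ ps → missing (filterᵇ q V) ≤ length ps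
    missing-≤ sub = ≤-trans (≤-reflexive (sym (length-missingPairs (filterᵇ q V))))
                            (unique-⊆-length (missingPairs-unique sorted) sub)

    ≤-missing : ∀ {ps} → Unique ps → ps ⊆ cliquePairs → length ps ≤ missing (filterᵇ q V)
    ≤-missing uniq sub = ≤-trans (unique-⊆-length uniq sub) (≤-reflexive (length-missingPairs (filterᵇ q V)))

-- The function edges lists each edge in increasing order.
orient : ∀ {n} → Fin n × Fin n → Fin n × Fin n
orient (i , j) = if toℕ i <ᵇ toℕ j then (i , j) else (j , i)

data Oriented {n} (i j : Fin n) : Fin n × Fin n → Set where
  forward  : toℕ i < toℕ j → Oriented i j (i , j)
  backward : toℕ j < toℕ i → Oriented i j (j , i)

oriented : ∀ {n} {i j : Fin n} → i ≢ j → Oriented i j (orient (i , j))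
oriented {i = i} {j} i≢j with toℕ i <ᵇ toℕ j in e
... | true  = forward (<ᵇ-true⁻ e)
... | false = backward (≤∧≢⇒< (≮⇒≥ λ i<j → not-¬ e (<ᵇ-true i<j)) (i≢j ∘ Fin.toℕ-injective ∘ sym))

orient-< : ∀ {n} {i j : Fin n} → toℕ i < toℕ j → orient (i , j) ≡ (i , j) × orient (j , i) ≡ (i , j)
orient-< {i = i} {j} i<j rewrite <ᵇ-true i<j = refl , lemma
  where
    lemma : orient (j , i) ≡ (i , j)
    lemma with toℕ j <ᵇ toℕ i in e
    ... | true  = ⊥-elim (<-asym i<j (<ᵇ-true⁻ e))
    ... | false = refl

chords : List (Fin 5 × Fin 5)
chords = (0F , 2F) ∷ (1F , 3F) ∷ (2F , 4F) ∷ (0F , 3F) ∷ (1F , 4F) ∷ []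

_≟²_ : (p q : Fin 5 × Fin 5) → Dec (p ≡ q)
_≟²_ = ≡-dec Fin._≟_ Fin._≟_

chord-complete : ∀ a b → a ≢ b → adj C₅ a b ≡ false → (a , b) ∈ chords ⊎ (b , a) ∈ chords
chord-complete = from-yes (Fin.all? λ a → Fin.all? λ b → ¬? (a Fin.≟ b) →-dec ((adj C₅ a b ≟ᵇ false) →-dec
  (Any.any? ((a , b) ≟²_) chords ⊎-dec Any.any? ((b , a) ≟²_) chords)))

chord-sound : ∀ {a b} → (a , b) ∈ chords → a ≢ b × adj C₅ a b ≡ false
chord-sound = All.lookup {P = λ (a , b) → a ≢ b × adj C₅ a b ≡ false}
  (from-yes (All.all? (λ (a , b) → ¬? (a Fin.≟ b) ×-dec (adj C₅ a b ≟ᵇ false)) chords))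

-- Both orders are compared because `place` may reverse a chord; the inequalities inside each pair
-- let `oriented` decide which way it goes.
Distinct : Fin 5 × Fin 5 → Fin 5 × Fin 5 → Set
Distinct (a , b) (c , d) = ((a , b) ≢ (c , d)) × ((a , b) ≢ (d , c)) × (a ≢ b) × (c ≢ d)

chords-distinct : AllPairs Distinct chords
chords-distinct = from-yes (allPairs? (λ (a , b) (c , d) →
  ¬? ((a , b) ≟² (c , d)) ×-dec (¬? ((a , b) ≟² (d , c)) ×-dec (¬? (a Fin.≟ b) ×-dec ¬? (c Fin.≟ d)))) chords)

module ChordPairs {n} (x : Fin 5 → Fin n) (inj : ∀ {i j} → x i ≡ x j → i ≡ j) where

  place : Fin 5 × Fin 5 → Fin n × Fin n
  place (a , b) = orient (x a , x b)

  chordPairs : List (Fin n × Fin n)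
  chordPairs = map place chords

  chordPairs-unique : Unique chordPairs
  chordPairs-unique = AllPairs.map⁺ (AllPairs.map (λ {p} {q} → distinct p q) chords-distinct)
    where
      distinct : ∀ p q → Distinct p q → place p ≢ place q
      distinct (a , b) (c , d) (≢₁ , ≢₂ , a≢b , c≢d) e
        with place (a , b) | oriented (a≢b ∘ inj) | place (c , d) | oriented (c≢d ∘ inj)
      distinct _ _ (≢₁ , ≢₂ , _) e | _ | forward _ | _ | forward _ =
        ≢₁ (cong₂ _,_ (inj (cong proj₁ e)) (inj (cong proj₂ e)))
      distinct _ _ (≢₁ , ≢₂ , _) e | _ | forward _ | _ | backward _ =
        ≢₂ (cong₂ _,_ (inj (cong proj₁ e)) (inj (cong proj₂ e)))
      distinct _ _ (≢₁ , ≢₂ , _) e | _ | backward _ | _ | forward _ =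
        ≢₂ (cong₂ _,_ (inj (cong proj₂ e)) (inj (cong proj₁ e)))
      distinct _ _ (≢₁ , ≢₂ , _) e | _ | backward _ | _ | backward _ =
        ≢₁ (cong₂ _,_ (inj (cong proj₂ e)) (inj (cong proj₁ e)))

  ∈-chordPairs⁺ : ∀ {i j a b} → i ≡ x a → j ≡ x b → toℕ i < toℕ j → adj C₅ a b ≡ false → (i , j) ∈ chordPairs
  ∈-chordPairs⁺ {a = a} {b} refl refl i<j e
    with chord-complete a b (λ { refl → <-irrefl refl i<j }) e
  ... | inj₁ p = subst (_∈ chordPairs) (proj₁ (orient-< i<j)) (∈-map⁺ place p)
  ... | inj₂ p = subst (_∈ chordPairs) (proj₂ (orient-< i<j)) (∈-map⁺ place p)

  data ChordPair : Fin n × Fin n → Set where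
    chordPair : ∀ {a b} → a ≢ b → adj C₅ a b ≡ false → toℕ (x a) < toℕ (x b) → ChordPair (x a , x b)

  ∈-chordPairs⁻ : ∀ {p} → p ∈ chordPairs → ChordPair p
  ∈-chordPairs⁻ p∈ with (a , b) , ab∈ , refl ← ∈-map⁻ place p∈ with a≢b , e ← chord-sound ab∈
    with place (a , b) | oriented (a≢b ∘ inj)
  ... | _ | forward l  = chordPair a≢b e l
  ... | _ | backward l = chordPair (≢-sym a≢b) (trans (Graph.sym C₅ b a) e) l

-- Completing a graph according to labels

∨-xor : ∀ a b → (b ≡ false → a ≡ false) → (a ∨ b) xor b ≡ false
∨-xor a     true  h rewrite ∨-zeroʳ a = refl
∨-xor a     false h rewrite h refl = refl

-- The edges that the structure demands. Between the clique and the independent side `false` only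
-- means that nothing is added; edges of `G` are free to remain.
desired : Fin 7 → Fin 7 → Bool
desired indepᴸ      _           = false
desired cliqueᴸ     indepᴸ      = false
desired cliqueᴸ     (suc _)     = true
desired (cornerᴸ _) indepᴸ      = false
desired (cornerᴸ _) cliqueᴸ     = true
desired (cornerᴸ i) (cornerᴸ j) = adj C₅ i j

desired-sym : ∀ l m → desired l m ≡ desired m l
desired-sym indepᴸ      indepᴸ      = refl
desired-sym indepᴸ      cliqueᴸ     = refl
desired-sym indepᴸ      (cornerᴸ _) = refl
desired-sym cliqueᴸ     indepᴸ      = refl
desired-sym cliqueᴸ     cliqueᴸ     = refl
desired-sym cliqueᴸ     (cornerᴸ _) = refl
desired-sym (cornerᴸ _) indepᴸ      = refl
desired-sym (cornerᴸ _) cliqueᴸ     = refl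
desired-sym (cornerᴸ i) (cornerᴸ j) = Graph.sym C₅ i j

module Fill {n} (G : Graph n) (lab : Fin n → Fin 7) where

  does-≟-sym : ∀ (u w : Fin n) → does (u Fin.≟ w) ≡ does (w Fin.≟ u)
  does-≟-sym u w with u Fin.≟ w
  ... | yes refl = sym (dec-true (u Fin.≟ u) refl)
  ... | no u≢w   = sym (dec-false (w Fin.≟ u) (≢-sym u≢w))

  fill : Graph n
  fill .adj u w    = desired (lab u) (lab w) ∧ not (adj G u w) ∧ not (does (u Fin.≟ w))
  fill .Graph.sym u w = cong₂ _∧_ (desired-sym (lab u) (lab w))
    (cong₂ _∧_ (cong not (Graph.sym G u w)) (cong not (does-≟-sym u w)))
  fill .irrefl u rewrite dec-true (u Fin.≟ u) refl with desired (lab u) (lab u) | adj G u u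
  ... | false | _     = refl
  ... | true  | false = refl
  ... | true  | true  = refl

  fill-adj : ∀ {u w} → u ≢ w → adj (G ∪ᴳ fill) u w ≡ adj G u w ∨ desired (lab u) (lab w)
  fill-adj {u} {w} u≢w rewrite dec-false (u Fin.≟ w) u≢w with adj G u w | desired (lab u) (lab w)
  ... | true  | _     = refl
  ... | false | true  = refl
  ... | false | false = refl

  fill-pseudosplit : (∀ u w → u ≢ w → clash (adj G u w ∨ desired (lab u) (lab w)) (lab u) (lab w) ≡ false) →
                     Pseudosplit (G ∪ᴳ fill)
  fill-pseudosplit h = conforms⇒pseudosplit {G = G ∪ᴳ fill} {lab} λ u w u≢w →
    trans (cong (λ b → clash b (lab u) (lab w)) (fill-adj u≢w)) (h u w u≢w)

  fill-edge⁻ : ∀ {u w} → adj fill u w ≡ true → desired (lab u) (lab w) ≡ true × adj G u w ≡ false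
  fill-edge⁻ {u} {w} e with d , e′ ← ∧-true⁻ {desired (lab u) (lab w)} e =
    d , not-true⁻ (proj₁ (∧-true⁻ {not (adj G u w)} e′))

-- Soundness and completeness of the decision

module Correctness {n} (G : Graph n) (k : ℕ) where

  open Algorithm G
  open Pairs G

  completion-from-split : ∀ q → Valid [] V q → missing (filterᵇ q V) ≤ k → PseudosplitCompletion G k
  completion-from-split q val le = fill , ≤-trans (≤-missing q (edges-unique fill) sub) le , fill-pseudosplit conf
    where
      lab : Fin n → Fin 7
      lab u = if q u then cliqueᴸ else indepᴸ
      open Fill G lab

      conf : ∀ u w → u ≢ w → clash (adj G u w ∨ desired (lab u) (lab w)) (lab u) (lab w) ≡ false
      conf u w _ with q u in qu | q w in qw
      ... | true  | true  = cong not (∨-zeroʳ (adj G u w))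
      ... | true  | false = refl
      ... | false | true  = refl
      ... | false | false = trans (∨-identityʳ _) (Valid.independent val (∈-allFin u) (∈-allFin w) qu qw)

      on-clique : ∀ u w → desired (lab u) (lab w) ≡ true → q u ≡ true × q w ≡ true
      on-clique u w d with q u | q w
      ... | true | true = refl , refl

      sub : edges fill ⊆ cliquePairs q
      sub {u , w} p with u<w , e ← ∈-edges⁻ fill p with d , uw ← fill-edge⁻ e with qu , qw ← on-clique u w d
        = ∈-cliquePairs⁺ q u<w qu qw uw

  module _ (x : Fin 5 → Fin n) (inj : ∀ {i j} → x i ≡ x j → i ≡ j)
           (no-chord : ∀ {i j} → i ≢ j → adj C₅ i j ≡ false → adj G (x i) (x j) ≡ false) where

    open ChordPairs x inj

    data Labelled (q : Fin n → Bool) (u : Fin n) : Fin 7 → Set where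
      at-corner  : ∀ {i} → u ≡ x i → Labelled q u (cornerᴸ i)
      in-clique  : q u ≡ true → Labelled q u cliqueᴸ
      in-indep : q u ≡ false → Labelled q u indepᴸ

    label : (q : Fin n → Bool) → Fin n → Fin 7
    label q u with Fin.any? (λ i → u Fin.≟ x i)
    ... | yes (i , _) = cornerᴸ i
    ... | no _        = if q u then cliqueᴸ else indepᴸ

    labelled : ∀ q u → Labelled q u (label q u)
    labelled q u with Fin.any? (λ i → u Fin.≟ x i)
    ... | yes (i , e) = at-corner e
    ... | no _ with q u in qu
    ...   | true  = in-clique qu
    ...   | false = in-indep qu

    label-corner : ∀ q i → label q (x i) ≡ cornerᴸ i
    label-corner q i with Fin.any? (λ j → x i Fin.≟ x j)
    ... | yes (j , e) = cong (λ m → cornerᴸ m) (sym (inj e))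
    ... | no ¬p       = ⊥-elim (¬p (i , refl))

    module FillAround
      (q : Fin n → Bool) (lab : Fin n → Fin 7)
      (view : ∀ u → Labelled q u (lab u)) (lab-corner : ∀ i → lab (x i) ≡ cornerᴸ i)
      (ind : ∀ {u w} → q u ≡ false → q w ≡ false → adj G u w ≡ false)
      (free : ∀ {u} i → q u ≡ false → u ≢ x i × adj G u (x i) ≡ false) where

      open Fill G lab

      conf : ∀ u w → u ≢ w → clash (adj G u w ∨ desired (lab u) (lab w)) (lab u) (lab w) ≡ false
      conf u w u≢w with lab u | view u | lab w | view w
      ... | _ | in-clique _   | _ | in-clique _   = cong not (∨-zeroʳ (adj G u w))
      ... | _ | in-clique _   | _ | in-indep _  = refl
      ... | _ | in-clique _   | _ | at-corner _   = cong not (∨-zeroʳ (adj G u w))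
      ... | _ | in-indep _  | _ | in-clique _   = refl
      ... | _ | in-indep qu | _ | in-indep qw = trans (∨-identityʳ _) (ind qu qw)
      ... | _ | in-indep qu | _ | at-corner {i} refl = trans (∨-identityʳ _) (proj₂ (free i qu))
      ... | _ | at-corner _   | _ | in-clique _   = cong not (∨-zeroʳ (adj G u w))
      ... | _ | at-corner {i} refl | _ | in-indep qw =
        trans (∨-identityʳ _) (trans (Graph.sym G u w) (proj₂ (free i qw)))
      ... | _ | at-corner {i} refl | _ | at-corner {j} refl
        rewrite dec-false (i Fin.≟ j) (λ { refl → u≢w refl }) =
        ∨-xor (adj G (x i) (x j)) (adj C₅ i j) (no-chord {i} {j} (λ { refl → u≢w refl }))

      q-corner : ∀ i → q (x i) ≡ true
      q-corner i = ¬-not λ qi → proj₁ (free i qi) refl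

      on-clique : ∀ u w → desired (lab u) (lab w) ≡ true → q u ≡ true × q w ≡ true
      on-clique u w d with lab u | view u | lab w | view w
      ... | _ | in-clique qu  | _ | in-clique qw   = qu , qw
      ... | _ | in-clique qu  | _ | at-corner refl = qu , q-corner _
      ... | _ | at-corner refl | _ | in-clique qw  = q-corner _ , qw
      ... | _ | at-corner refl | _ | at-corner refl = q-corner _ , q-corner _

      sub : edges fill ++ chordPairs ⊆ cliquePairs q
      sub {u , w} p with ∈-++⁻ (edges fill) p
      ... | inj₁ p′ with u<w , e ← ∈-edges⁻ fill p′ with d , uw ← fill-edge⁻ {u} {w} e with qu , qw ← on-clique u w d
        = ∈-cliquePairs⁺ q u<w qu qw uw
      ... | inj₂ p′ with chordPair a≢b e l ← ∈-chordPairs⁻ p′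
        = ∈-cliquePairs⁺ q l (q-corner _) (q-corner _) (no-chord a≢b e)

      disjoint : ∀ {p} → p ∈ edges fill → p ∈ chordPairs → ⊥
      disjoint p p′ with chordPair {a} {b} _ e _ ← ∈-chordPairs⁻ p′ with _ , s ← ∈-edges⁻ fill p
        = not-¬ e (trans (sym (cong₂ desired (lab-corner a) (lab-corner b))) (proj₁ (fill-edge⁻ {x a} {x b} s)))

      -- All corners are on the clique side of `q`, so the five chords are among its missing pairs.
      -- They are never filled, since `desired` is false on them; hence they and the added edges are
      -- disjoint parts of the same count.
      count : 5 + ∣E∣ fill ≤ missing (filterᵇ q V)
      count = begin
        5 + ∣E∣ fill                        ≡⟨ +-comm 5 (∣E∣ fill) ⟩
        length (edges fill) + length chordPairs ≡⟨ sym (length-++ (edges fill)) ⟩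
        length (edges fill ++ chordPairs)   ≤⟨ ≤-missing q (Unique.++⁺ (edges-unique fill) chordPairs-unique (λ (p , p′) → disjoint p p′)) sub ⟩
        missing (filterᵇ q V)               ∎
        where open ≤-Reasoning

      completion : missing (filterᵇ q V) ≤ 5 + k → PseudosplitCompletion G k
      completion le = fill , +-cancelˡ-≤ 5 _ _ (≤-trans count le) , fill-pseudosplit conf

    completion-from-pentagon : ∀ q →
      (∀ {u w} → q u ≡ false → q w ≡ false → adj G u w ≡ false) →
      (∀ {u} i → q u ≡ false → u ≢ x i × adj G u (x i) ≡ false) →
      missing (filterᵇ q V) ≤ 5 + k → PseudosplitCompletion G k
    completion-from-pentagon q = FillAround.completion q (label q) (labelled q) (label-corner q)

  solution : ∀ {k′ X} → is-just (solve k′ X V) ≡ true → ∃[ q ] Valid X V q × missing (filterᵇ q V) ≤ k′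
  solution {k′} {X} e with solve k′ X V in eq
  ... | just C with q , refl , val , le ← solve-sound k′ X V eq = q , val , le

  check-sound : ∀ X → check (5 + k) V X ≡ true → PseudosplitCompletion G k
  check-sound X e with nodup , e′ ← ∧-true⁻ {not (duplicate X)} e with nochord , sol ← ∧-true⁻ {not (chord X)} e′
    = from-list X (not-true⁻ nodup) (not-true⁻ nochord) (solution sol)
    where
      from-list : ∀ X → duplicate X ≡ false → chord X ≡ false →
        (∃[ q ] Valid X V q × missing (filterᵇ q V) ≤ 5 + k) → PseudosplitCompletion G k
      from-list (a ∷ b ∷ c ∷ d ∷ e ∷ Y) dup ch (q , val , le) =
        completion-from-pentagon x inj no-chord q
          (Valid.independent val (∈-allFin _) (∈-allFin _)) free le
        where
          X′ = a ∷ b ∷ c ∷ d ∷ e ∷ Y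
          x : Fin 5 → Fin n
          x = Vec.lookup (a ∷ b ∷ c ∷ d ∷ e ∷ [])

          x∈ : ∀ i → x i ∈ X′
          x∈ 0F = here refl
          x∈ 1F = there (here refl)
          x∈ 2F = there (there (here refl))
          x∈ 3F = there (there (there (here refl)))
          x∈ 4F = there (there (there (there (here refl))))

          tail-∉ : ∀ {y L} → duplicate (y ∷ L) ≡ false → ∀ {z} → z ∈ L → y ≢ z
          tail-∉ {y} {L} h z∈ refl = memb-false⁻ {y} {L} (proj₁ (∨-false⁻ h)) z∈

          dup₁ = proj₂ (∨-false⁻ {memb a (b ∷ c ∷ d ∷ e ∷ Y)} dup)
          dup₂ = proj₂ (∨-false⁻ {memb b (c ∷ d ∷ e ∷ Y)} dup₁)
          dup₃ = proj₂ (∨-false⁻ {memb c (d ∷ e ∷ Y)} dup₂)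

          a∉ : ∀ {z} → z ∈ b ∷ c ∷ d ∷ e ∷ Y → a ≢ z
          a∉ = tail-∉ dup
          b∉ : ∀ {z} → z ∈ c ∷ d ∷ e ∷ Y → b ≢ z
          b∉ = tail-∉ dup₁
          c∉ : ∀ {z} → z ∈ d ∷ e ∷ Y → c ≢ z
          c∉ = tail-∉ dup₂
          d∉ : ∀ {z} → z ∈ e ∷ Y → d ≢ z
          d∉ = tail-∉ dup₃

          inj : ∀ {i j} → x i ≡ x j → i ≡ j
          inj {0F} {0F} _ = refl
          inj {0F} {1F} p = ⊥-elim (a∉ (here refl) p)
          inj {0F} {2F} p = ⊥-elim (a∉ (there (here refl)) p)
          inj {0F} {3F} p = ⊥-elim (a∉ (there (there (here refl))) p)
          inj {0F} {4F} p = ⊥-elim (a∉ (there (there (there (here refl)))) p)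
          inj {1F} {0F} p = ⊥-elim (a∉ (here refl) (sym p))
          inj {1F} {1F} _ = refl
          inj {1F} {2F} p = ⊥-elim (b∉ (here refl) p)
          inj {1F} {3F} p = ⊥-elim (b∉ (there (here refl)) p)
          inj {1F} {4F} p = ⊥-elim (b∉ (there (there (here refl))) p)
          inj {2F} {0F} p = ⊥-elim (a∉ (there (here refl)) (sym p))
          inj {2F} {1F} p = ⊥-elim (b∉ (here refl) (sym p))
          inj {2F} {2F} _ = refl
          inj {2F} {3F} p = ⊥-elim (c∉ (here refl) p)
          inj {2F} {4F} p = ⊥-elim (c∉ (there (here refl)) p)
          inj {3F} {0F} p = ⊥-elim (a∉ (there (there (here refl))) (sym p))
          inj {3F} {1F} p = ⊥-elim (b∉ (there (here refl)) (sym p))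
          inj {3F} {2F} p = ⊥-elim (c∉ (here refl) (sym p))
          inj {3F} {3F} _ = refl
          inj {3F} {4F} p = ⊥-elim (d∉ (here refl) p)
          inj {4F} {0F} p = ⊥-elim (a∉ (there (there (there (here refl)))) (sym p))
          inj {4F} {1F} p = ⊥-elim (b∉ (there (there (here refl))) (sym p))
          inj {4F} {2F} p = ⊥-elim (c∉ (there (here refl)) (sym p))
          inj {4F} {3F} p = ⊥-elim (d∉ (here refl) (sym p))
          inj {4F} {4F} _ = refl

          chord-false : ∀ {i j} → (i , j) ∈ chords → adj G (x i) (x j) ≡ false
          chord-false p with ac , ch₁ ← ∨-false⁻ {adj G a c} ch with bd , ch₂ ← ∨-false⁻ {adj G b d} ch₁
            with ce , ch₃ ← ∨-false⁻ {adj G c e} ch₂ with ad , be ← ∨-false⁻ {adj G a d} ch₃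
            = All.lookup {P = λ (i , j) → adj G (x i) (x j) ≡ false} (ac ∷ bd ∷ ce ∷ ad ∷ be ∷ []) p

          no-chord : ∀ {i j} → i ≢ j → adj C₅ i j ≡ false → adj G (x i) (x j) ≡ false
          no-chord {i} {j} i≢j h with chord-complete i j i≢j h
          ... | inj₁ p = chord-false p
          ... | inj₂ p = trans (Graph.sym G (x i) (x j)) (chord-false p)

          free : ∀ {u} i → q u ≡ false → u ≢ x i × adj G u (x i) ≡ false
          free {u} i qu with no-memb , no-adj ← ∨-false⁻ {memb u X′} (not-true⁻ (Valid.permitted val (∈-allFin u) qu))
            = (λ { refl → memb-false⁻ {u} {X′} no-memb (x∈ i) }) , any-false⁻ {p = adj G u} no-adj (x∈ i)

  guess-sound : ∀ d X → guess (5 + k) d V X ≡ true → PseudosplitCompletion G k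
  guess-sound zero    X e = check-sound X e
  guess-sound (suc d) X e with u , _ , e′ ← any⁻ V e = guess-sound d (u ∷ X) e′

  decide-sound : decide k ≡ true → PseudosplitCompletion G k
  decide-sound e with is-just (solve k [] V) in eq
  ... | true  with q , val , le ← solution eq = completion-from-split q val le
  ... | false = guess-sound 5 [] e

  no-solution : ∀ {k′ X} → is-just (solve k′ X V) ≡ false → ∀ {q} → Valid X V q → ¬ missing (filterᵇ q V) ≤ k′
  no-solution {k′} {X} e with solve k′ X V in eq
  ... | nothing = solve-complete k′ X V eq

  module _ (S : Graph n) (pseudosplit : Pseudosplit (G ∪ᴳ S)) where

    private
      G′ = G ∪ᴳ S
    open Structure G′

    subgraph : ∀ {u w} → adj G′ u w ≡ false → adj G u w ≡ false
    subgraph e = proj₁ (∨-false⁻ e)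

    new-edge : ∀ {u w} → toℕ u < toℕ w → adj G u w ≡ false → adj G′ u w ≡ true → (u , w) ∈ edges S
    new-edge {u} {w} u<w e e′ rewrite e = ∈-edges⁺ S u<w e′

    split-solution : ∀ {s} → Split (_∈ V) s → Valid [] V s × missing (filterᵇ s V) ≤ ∣E∣ S
    split-solution {s} split = record { independent = ind ; permitted = λ _ _ → refl } , missing-≤ s sub
      where
        ind : ∀ {u w} → u ∈ V → w ∈ V → s u ≡ false → s w ≡ false → adj G u w ≡ false
        ind {u} {w} u∈ w∈ su sw with u Fin.≟ w
        ... | yes refl = irrefl G u
        ... | no u≢w   = subgraph (trans (split u∈ w∈ u≢w (trans su (sym sw))) su)
        sub : cliquePairs s ⊆ edges S
        sub {u , w} p with u<w , su , sw , e ← ∈-cliquePairs⁻ s p =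
          new-edge u<w e (trans (split (∈-allFin u) (∈-allFin w) (λ { refl → <-irrefl refl u<w }) (trans su (sym sw))) su)

    module _ (p : Pentagon) where
      open Pentagon p renaming (corner to x)
      open AroundPentagon pseudosplit p
      open ChordPairs x corner-injective

      X : List (Fin n)
      X = tabulate x

      q : Fin n → Bool
      q u = memb u X ∨ side u

      outside : ∀ {u} → memb u X ≡ false → Outside u
      outside {u} h i refl = memb-false⁻ {u} {X} h (∈-tabulate⁺ {f = x} i)

      -- The clique side consists of the corners and the vertices complete to them. Each of its
      -- pairs is an edge of the completed graph, and so belongs to `S` when `G` lacks it, unless it
      -- is one of the five chords.
      pentagon-solution : Valid X V q × missing (filterᵇ q V) ≤ 5 + ∣E∣ S
      pentagon-solution = record { independent = λ _ _ → ind ; permitted = λ {u} _ → per {u} } ,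
        ≤-trans (missing-≤ q sub) (≤-reflexive (trans (length-++ (edges S)) (+-comm (∣E∣ S) 5)))
        where
          ind : ∀ {u w} → q u ≡ false → q w ≡ false → adj G u w ≡ false
          ind {u} {w} qu qw with u Fin.≟ w
          ... | yes refl = irrefl G u
          ... | no u≢w with mu , su ← ∨-false⁻ {memb u X} qu | mw , sw ← ∨-false⁻ {memb w X} qw
            = subgraph (trans (outside-split (outside {u} mu) (outside {w} mw) u≢w (trans su (sym sw))) su)

          per : ∀ {u} → q u ≡ false → allowed X u ≡ true
          per {u} qu with mu , su ← ∨-false⁻ {memb u X} qu = cong not (cong₂ _∨_ mu (any-false⁺ X no-adj))
            where
              no-adj : ∀ {w} → w ∈ X → adj G u w ≡ false
              no-adj w∈ with i , refl ← ∈-tabulate⁻ {f = x} w∈ = subgraph (trans (corners-uniform (outside {u} mu) i) su)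

          memb-X : ∀ {u} → memb u X ≡ true → ∃[ i ] u ≡ x i
          memb-X h = ∈-tabulate⁻ {f = x} (memb⁻ X h)

          sub : cliquePairs q ⊆ edges S ++ chordPairs
          sub {u , w} p with u<w , qu , qw , e ← ∈-cliquePairs⁻ q p with memb u X in mu | memb w X in mw
          ... | false | false = ∈-++⁺ˡ (new-edge u<w e
                  (trans (outside-split (outside {u} mu) (outside {w} mw) (λ { refl → <-irrefl refl u<w }) (trans qu (sym qw))) qu))
          ... | false | true with i , refl ← memb-X {w} mw =
                  ∈-++⁺ˡ (new-edge u<w e (trans (corners-uniform (outside {u} mu) i) qu))
          ... | true | false with i , refl ← memb-X {u} mu =
                  ∈-++⁺ˡ (new-edge u<w e (trans (Graph.sym G′ u w) (trans (corners-uniform (outside {w} mw) i) qw)))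
          ... | true | true with i , refl ← memb-X {u} mu | j , refl ← memb-X {w} mw with adj C₅ i j in c
          ...   | true  = ∈-++⁺ˡ (new-edge u<w e (trans (corner-adj i j) c))
          ...   | false = ∈-++⁺ʳ (edges S) (∈-chordPairs⁺ refl refl u<w c)

      no-duplicate : ∀ {m} (f : Fin m → Fin n) → (∀ {i j} → f i ≡ f j → i ≡ j) → duplicate (tabulate f) ≡ false
      no-duplicate {zero}  f inj = refl
      no-duplicate {suc m} f inj = cong₂ _∨_ (¬-not λ h → case-zero (∈-tabulate⁻ {f = f ∘ suc} (memb⁻ (tabulate (f ∘ suc)) h)))
                                             (no-duplicate (f ∘ suc) (Fin.suc-injective ∘ inj))
        where
          case-zero : (∃[ i ] f zero ≡ f (suc i)) → ⊥
          case-zero (i , e) with () ← inj e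

      no-chords : chord X ≡ false
      no-chords rewrite subgraph (corner-adj 0F 2F) | subgraph (corner-adj 1F 3F) | subgraph (corner-adj 2F 4F)
                      | subgraph (corner-adj 0F 3F) = subgraph (corner-adj 1F 4F)

      check-complete : ∣E∣ S ≤ k → check (5 + k) V X ≡ true
      check-complete le rewrite no-duplicate x corner-injective | no-chords =
        ¬-not λ h → no-solution h (proj₁ pentagon-solution) (≤-trans (proj₂ pentagon-solution) (+-monoʳ-≤ 5 le))

      guess-complete : ∣E∣ S ≤ k → guess (5 + k) 5 V [] ≡ true
      guess-complete le =
        -- `guess` prepends each new vertex, so the corners are guessed in reverse to obtain the
        -- list `X`.
        any⁺ (∈-allFin (x 4F)) (any⁺ (∈-allFin (x 3F)) (any⁺ (∈-allFin (x 2F)) (any⁺ (∈-allFin (x 1F))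
          (any⁺ (∈-allFin (x 0F)) (check-complete le)))))

  decide-complete : PseudosplitCompletion G k → decide k ≡ true
  decide-complete (S , le , ps) with Structure.split-or-pentagon (G ∪ᴳ S) ps V
  ... | inj₁ (s , split) with val , miss ← split-solution S ps split
    = cong (_∨ guess (5 + k) 5 V []) (¬-not λ h → no-solution h val (≤-trans miss le))
  ... | inj₂ p = trans (cong (is-just (solve k [] V) ∨_) (guess-complete S ps p le)) (∨-zeroʳ _)

  decide-reflects : Reflects (PseudosplitCompletion G k) (decide k)
  decide-reflects with decide k in e
  ... | true  = ofʸ (decide-sound e)
  ... | false = ofⁿ λ c → not-¬ e (decide-complete c)

-- The running time

sqrt-upper : ∀ k → k < suc ⌊√ k ⌋ * suc ⌊√ k ⌋
sqrt-upper zero = s≤s z≤n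
sqrt-upper (suc k) with suc ⌊√ k ⌋ * suc ⌊√ k ⌋ ≤ᵇ suc k in e
... | true  = ≤-<-trans (sqrt-upper k) (*-mono-< r<1+r r<1+r)
  where r<1+r = n<1+n (suc ⌊√ k ⌋)
... | false = ≰⇒> λ le → not-¬ e (≤ᵇ-true le)

n<2^n : ∀ n → n < 2 ^ n
n<2^n zero    = s≤s z≤n
n<2^n (suc n) = begin
  suc (suc n)       ≤⟨ s≤s (n<2^n n) ⟩
  suc (2 ^ n)       ≤⟨ +-monoˡ-≤ (2 ^ n) (m^n>0 2 n) ⟩
  2 ^ n + 2 ^ n     ≡⟨ cong (2 ^ n +_) (sym (+-identityʳ (2 ^ n))) ⟩
  2 ^ suc n         ∎
  where open ≤-Reasoning

^-distribʳ-* : ∀ a b m → (a * b) ^ m ≡ a ^ m * b ^ m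
^-distribʳ-* a b zero    = refl
^-distribʳ-* a b (suc m) = trans (cong (a * b *_) (^-distribʳ-* a b m)) (interchange a b (a ^ m) (b ^ m))
  where
    interchange : ∀ a b c d → a * b * (c * d) ≡ a * c * (b * d)
    interchange = solve-∀

module Bounds (n k : ℕ) where

  -- The offset 3 in `s` gives 5 + k ≤ s², also for r = 0. `Q` must dominate 16, `n`, 5 + k and the
  -- candidate count 2 · 2^s (1 + n 2^s); the factor 2^4 takes care of the 16.
  r s Q : ℕ
  r = ⌊√ k ⌋
  s = 3 + r
  Q = 2 ^ (4 + 2 * s) * (1 + n)

  2^2s : 2 ^ (2 * s) ≡ 2 ^ s * 2 ^ s
  2^2s = trans (cong (2 ^_) (cong (s +_) (+-identityʳ s))) (^-distribˡ-+-* 2 s s)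

  Q≡ : Q ≡ 16 * (2 ^ s * 2 ^ s) * (1 + n)
  Q≡ = cong (_* (1 + n)) (trans (^-distribˡ-+-* 2 4 (2 * s)) (cong (16 *_) 2^2s))

  5+k≤s*s : 5 + k ≤ s * s
  5+k≤s*s = begin
    5 + k                             ≤⟨ +-mono-≤ (m≤m+n 5 (3 + 4 * r)) (<⇒≤ (sqrt-upper k)) ⟩
    (8 + 4 * r) + suc r * suc r       ≡⟨ expand r ⟩
    s * s                             ∎
    where
      open ≤-Reasoning
      expand : ∀ r → (8 + 4 * r) + suc r * suc r ≡ (3 + r) * (3 + r)
      expand = solve-∀

  1≤2^s² : 1 ≤ 2 ^ s * 2 ^ s
  1≤2^s² = *-mono-≤ (m^n>0 2 s) (m^n>0 2 s)

  16≤Q : 16 ≤ Q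
  16≤Q = begin
    16 * 1 * 1                      ≤⟨ *-mono-≤ (*-monoʳ-≤ 16 1≤2^s²) (s≤s z≤n) ⟩
    16 * (2 ^ s * 2 ^ s) * (1 + n)  ≡⟨ sym Q≡ ⟩
    Q                               ∎
    where open ≤-Reasoning

  n≤Q : n ≤ Q
  n≤Q = ≤-trans (n≤1+n n) (≤-trans (≤-reflexive (sym (*-identityˡ (1 + n)))) (*-monoˡ-≤ (1 + n) (m^n>0 2 (4 + 2 * s))))

  5+k≤Q : 5 + k ≤ Q
  5+k≤Q = begin
    5 + k                           ≤⟨ 5+k≤s*s ⟩
    s * s                           ≤⟨ *-mono-≤ (<⇒≤ (n<2^n s)) (<⇒≤ (n<2^n s)) ⟩
    2 ^ s * 2 ^ s                   ≡⟨ sym (trans (*-identityʳ _) (*-identityˡ _)) ⟩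
    1 * (2 ^ s * 2 ^ s) * 1         ≤⟨ *-mono-≤ (*-monoˡ-≤ (2 ^ s * 2 ^ s) {1} {16} (s≤s z≤n)) (s≤s z≤n) ⟩
    16 * (2 ^ s * 2 ^ s) * (1 + n)  ≡⟨ sym Q≡ ⟩
    Q                               ∎
    where open ≤-Reasoning

  module _ (G : Graph n) where
    open Algorithm G

    -- The missing pairs at the new vertex `v` are not controlled, so `v` is split off at the price
    -- of a factor 2. The rest has at most s · s missing pairs, hence at most `s` branchings on
    -- vertices with more than `s` non-neighbours.
    few-sets : ∀ X v C → missing C ≤ 5 + k → length C ≤ n → length (indepSets (filterᵇ (allowed X) (v ∷ C))) ≤ Q
    few-sets X v C miss len = begin
      length (indepSets (filterᵇ (allowed X) (v ∷ C))) ≤⟨ head ⟩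
      2 * length (indepSets D)                         ≤⟨ *-monoʳ-≤ 2 (length-indepSets-bound s (length D) s D ≤-refl
                                                            (≤-trans (missing-mono (filterᵇ-⊑ {p = allowed X} C)) (≤-trans miss 5+k≤s*s))) ⟩
      2 * (2 ^ s * (1 + length D * 2 ^ s))             ≤⟨ *-monoʳ-≤ 2 (*-monoʳ-≤ (2 ^ s)
                                                            (+-mono-≤ (m^n>0 2 s) (*-monoˡ-≤ (2 ^ s) (≤-trans (length-mono-≤ (filterᵇ-⊑ {p = allowed X} C)) len)))) ⟩
      2 * (2 ^ s * (2 ^ s + n * 2 ^ s))                ≡⟨ arrange (2 ^ s) n ⟩
      2 * (2 ^ s * 2 ^ s) * (1 + n)                    ≤⟨ *-monoˡ-≤ (1 + n) (*-monoˡ-≤ (2 ^ s * 2 ^ s) {2} {16} (s≤s (s≤s z≤n))) ⟩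
      16 * (2 ^ s * 2 ^ s) * (1 + n)                   ≡⟨ sym Q≡ ⟩
      Q                                                ∎
      where
        open ≤-Reasoning
        D = filterᵇ (allowed X) C
        arrange : ∀ a n → 2 * (a * (a + n * a)) ≡ 2 * (a * a) * (1 + n)
        arrange = solve-∀
        head : length (indepSets (filterᵇ (allowed X) (v ∷ C))) ≤ 2 * length (indepSets D)
        head with allowed X v
        ... | true  = length-indepSets-∷-≤ v D
        ... | false = m≤m+n _ _

exponent : ℕ → ℕ → ℕ
exponent d k = (4 + 2 * (3 + ⌊√ k ⌋)) * d

exponent-∈O : ∀ d → exponent d ∈O (λ k → ⌊√ k ⌋ * ⌊log₂ k ⌋)
-- From k = 2 on, both the root and the logarithm are at least 1, so 10 + 2r ≤ 12r ≤ 12r log₂ k for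
-- r = ⌊√k⌋.
exponent-∈O d = 12 * d , 2 , λ k 2≤k → bound k (1≤√ k 2≤k) (⌊log₂⌋-mono-≤ 2≤k)
  where
    1≤√ : ∀ k → 2 ≤ k → 1 ≤ ⌊√ k ⌋
    1≤√ k 2≤k with ⌊√ k ⌋ | sqrt-upper k
    ... | zero  | k<1 = ⊥-elim (<⇒≱ k<1 (≤-trans (n≤1+n 1) 2≤k))
    ... | suc _ | _   = s≤s z≤n

    bound : ∀ k → 1 ≤ ⌊√ k ⌋ → 1 ≤ ⌊log₂ k ⌋ → exponent d k ≤ 12 * d * (⌊√ k ⌋ * ⌊log₂ k ⌋)
    bound k 1≤r 1≤l = begin
      (4 + 2 * (3 + ⌊√ k ⌋)) * d              ≡⟨ cong (_* d) (expand ⌊√ k ⌋) ⟩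
      (10 * 1 + 2 * ⌊√ k ⌋) * d               ≤⟨ *-monoˡ-≤ d (+-monoˡ-≤ _ (*-monoʳ-≤ 10 1≤r)) ⟩
      (10 * ⌊√ k ⌋ + 2 * ⌊√ k ⌋) * d          ≡⟨ collect ⌊√ k ⌋ d ⟩
      12 * d * (⌊√ k ⌋ * 1)                   ≤⟨ *-monoʳ-≤ (12 * d) (*-monoʳ-≤ ⌊√ k ⌋ 1≤l) ⟩
      12 * d * (⌊√ k ⌋ * ⌊log₂ k ⌋)           ∎
      where
        open ≤-Reasoning
        expand : ∀ r → 4 + 2 * (3 + r) ≡ 10 * 1 + 2 * r
        expand = solve-∀
        collect : ∀ r d → (10 * r + 2 * r) * d ≡ 12 * d * (r * 1)
        collect = solve-∀

RunsOn : Term 1 → Set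
RunsOn e₀ = ∀ Q {n} (G : Graph n) k → n ≤ Q → 5 + k ≤ Q →
  (∀ X v C → Algorithm.missing G C ≤ 5 + k → length C ≤ n →
    length (Algorithm.indepSets G (filterᵇ (Algorithm.allowed G X) (v ∷ C))) ≤ Q) →
  Run._⊨_⇒_ Q ((encodeGraph G ∙ encodeℕ k) ∷ []) e₀ (encodeBool (Algorithm.decide G k))

runs⇒decides : ∀ e₀ {n} (G : Graph n) k Q a → 16 ≤ Q → Q ≡ 2 ^ a * (1 + n) →
  Run._⊨_⇒_ Q ((encodeGraph G ∙ encodeℕ k) ∷ []) e₀ (encodeBool (Algorithm.decide G k)) →
  compileProgram e₀ on (encodeGraph G ∙ encodeℕ k) Decides PseudosplitCompletion G k
    Within (2 ^ (a * deg e₀) * (1 + n) ^ deg e₀)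
runs⇒decides e₀ {n} G k Q a 16≤Q Q≡ run with t , d , t≤ ← Run.compileProgram-⇓ Q 16≤Q e₀ run =
  Algorithm.decide G k , t , d , Correctness.decide-reflects G k , (begin
    t                                        ≤⟨ t≤ ⟩
    Q ^ deg e₀                               ≡⟨ cong (_^ deg e₀) Q≡ ⟩
    (2 ^ a * (1 + n)) ^ deg e₀               ≡⟨ ^-distribʳ-* (2 ^ a) (1 + n) (deg e₀) ⟩
    (2 ^ a) ^ deg e₀ * (1 + n) ^ deg e₀      ≡⟨ cong (_* (1 + n) ^ deg e₀) (^-*-assoc 2 a (deg e₀)) ⟩
    2 ^ (a * deg e₀) * (1 + n) ^ deg e₀      ∎)
  where open ≤-Reasoning

runs⇒subexponential : ∀ e₀ → RunsOn e₀ →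
    ∃[ P ] ∃[ f ] ∃[ c ]
      (f ∈O (λ k → ⌊√ k ⌋ * ⌊log₂ k ⌋))
      × (∀ {n : ℕ} (G : Graph n) (k : ℕ) →
           P on (encodeGraph G ∙ encodeℕ k)
             Decides PseudosplitCompletion G k
             Within (2 ^ f k * (1 + n) ^ c))
runs⇒subexponential e₀ run = compileProgram e₀ , exponent (deg e₀) , deg e₀ , exponent-∈O (deg e₀) ,
  λ {n} G k → runs⇒decides e₀ G k (Bounds.Q n k) (4 + 2 * (3 + ⌊√ k ⌋)) (Bounds.16≤Q n k) refl
    (run (Bounds.Q n k) G k (Bounds.n≤Q n k) (Bounds.5+k≤Q n k) (Bounds.few-sets n k G))

mainᵗ-runs : RunsOn mainᵗ
mainᵗ-runs Q G k n≤Q 5+k≤Q = Runs.main-⇒ Q G n≤Q k 5+k≤Q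

theorem4p3 :
  ∃[ P ] ∃[ f ] ∃[ c ]
    (f ∈O (λ k → ⌊√ k ⌋ * ⌊log₂ k ⌋))
    × (∀ {n : ℕ} (G : Graph n) (k : ℕ) →
         P on (encodeGraph G ∙ encodeℕ k)
           Decides PseudosplitCompletion G k
           Within (2 ^ f k * (1 + n) ^ c))
theorem4p3 = runs⇒subexponential mainᵗ mainᵗ-runs
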